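{- Let $T$ be a regular tournament of order $2n+1\geq 11$ and let $S$ be a subset of $V(T)$ with $|S|\leq \frac{1}{2}(n-2)$. Let $x,y$ be two distinct vertices in $V(T)\setminus S$. If the subtournament $T-S$ contains an $(x,y)$-path of length $r$, where $r\in [3, 2n-|S|-1]$, then $T-S$ also contains an $(x,y)$-path of length $r+1$.
   Context: A tournament is an oriented graph in which every pair of distinct vertices is joined by exactly one arc. A tournament is regular if every vertex has outdegree equal to its indegree. $T-S$ denotes the subtournament induced by $V(T)\setminus S$. Paths are directed and simple; the length of a path is its number of arcs; an $(x,y)$-path is a directed path from $x$ to $y$. $[a,b]$ denotes the set of integers $\{a,a+1,\dots,b\}$. -}

module Defs where

open import Data.Nat using (ℕ; suc; _+_; _*_)
open import Data.Bool using (Bool; true; false; T; not)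
open import Data.Fin using (Fin)
open import Data.Fin.Subset using (Subset; _∉_)
open import Data.List using (List; []; _∷_; length; filter)
open import Data.List.Relation.Unary.All using (All)
open import Data.List.Relation.Unary.Unique.Propositional using (Unique)
open import Data.List.Base using (head; last)
open import Data.Maybe using (just)
open import Data.Unit using (⊤)
open import Data.Product using (_×_)
open import Relation.Binary.PropositionalEquality using (_≡_; _≢_)
open import Data.List using (allFin)

-- A digraph on vertex set Fin m, given by a Boolean arc relation:
-- adj u v ≡ true  means there is an arc u → v.
Digraph : ℕ → Set
Digraph m = Fin m → Fin m → Bool

record IsTournament {m : ℕ} (A : Digraph m) : Set where
  field
    irreflexive : ∀ u → A u u ≡ false
    exactly-one : ∀ u v → u ≢ v → A u v ≡ not (A v u)

outdeg : {m : ℕ} → Digraph m → Fin m → ℕ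
outdeg {m} A u = length (filter (λ v → T? (A u v)) (allFin m))
  where
  open import Data.Bool.Properties using (T?)

indeg : {m : ℕ} → Digraph m → Fin m → ℕ
indeg {m} A u = length (filter (λ v → T? (A v u)) (allFin m))
  where
  open import Data.Bool.Properties using (T?)

IsRegular : {m : ℕ} → Digraph m → Set
IsRegular A = ∀ u → outdeg A u ≡ indeg A u

Walk : {m : ℕ} → Digraph m → List (Fin m) → Set
Walk A []           = ⊤
Walk A (u ∷ [])     = ⊤
Walk A (u ∷ v ∷ vs) = T (A u v) × Walk A (v ∷ vs)

record PathAvoiding {m : ℕ} (A : Digraph m) (S : Subset m)
                    (x y : Fin m) (r : ℕ) : Set where
  field
    verts    : List (Fin m)
    len      : length verts ≡ suc r
    starts   : head verts ≡ just x
    ends     : last verts ≡ just y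
    distinct : Unique verts
    avoids   : All (_∉ S) verts
    arcs     : Walk A verts

{-# OPTIONS --safe #-}
-- Let W be the complement of S, k = n - |S|, and let X, Y be the sets of out-neighbours of x and of
-- in-neighbours of y in W.  In W all degrees lie between k and n, |W| = n + k + 1 and n + 2 ≤ 2k.
--
-- In a tournament two internally disjoint (x,y)-paths can be merged, as in merge sort, into one path on the
-- union of their vertex sets.  Let P and Q be two such paths, K their union and D = W \ K, and let p ∈ P
-- and q ∈ Q.  A path R in D leading from an out-neighbour of p to an in-neighbour of q gives an (x,y)-path on
-- K ∪ R, as the rests of P and Q can be merged into it.  If D has a Hamiltonian cycle and no such path R on
-- a given number of vertices exists, then shifting the cycle embeds the out-neighbours of p in D into those
-- of q; by symmetry all inner vertices of P and Q have equally many out-neighbours in D.  Releasing the second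
-- vertex a′ of Q into D and comparing again, one gets a contradiction if a → a′ for the second vertex a of P.
-- If D has no Hamiltonian cycle, then its initial and its terminal strong component must be large by the
-- degree conditions, and there is no room for both.
--
-- Hence a path of the wanted length exists as soon as there are two disjoint (x,y)-paths with two or three
-- inner vertices each, or three vertices in X ∩ Y.  Counting the neighbours of a vertex of small outdegree
-- in X \ Y and of a vertex of small indegree in Y \ X shows that one of the two always happens.
module Submission where

open import Defs
open import Data.Nat using (ℕ; zero; suc; _+_; _*_; _∸_; _≤_; _<_; z≤n; s≤s; _≤?_)
open import Data.Nat.Properties hiding (_≟_)
open import Data.Nat.Tactic.RingSolver using (solve-∀)
open import Data.Bool using (Bool; true; false; T; not; _∧_)
open import Data.Bool.Properties using (T?)
open import Data.Fin using (Fin; zero; suc; _≟_)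
open import Data.Fin.Properties using (any?)
open import Data.Fin.Subset using (Subset; ∣_∣; _∉_)
open import Data.Fin.Subset.Properties using (_∈?_)
open import Data.List using (List; []; _∷_; [_]; _++_; length; tabulate; filter; allFin; last)
open import Data.List.Properties using (length-++; length-tabulate) renaming (++-assoc to ++-assoc≡; ++-identityʳ to ++-identityʳ≡)
open import Data.List.Membership.Propositional using (_∈_; find)
open import Data.List.Membership.Propositional.Properties using (∈-++⁺ˡ; ∈-++⁺ʳ; ∈-++⁻; ∈-∃++; ∈-allFin)
open import Data.List.Relation.Unary.All as All using (All; []; _∷_)
open import Data.List.Relation.Unary.Any as Any using (Any; here; there)
open import Data.List.Relation.Unary.AllPairs as AllPairs using ([]; _∷_; allPairs?)
open import Data.List.Relation.Unary.Unique.Propositional using (Unique)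
open import Data.List.Relation.Unary.Unique.Propositional.Properties using (allFin⁺)
open import Data.List.Relation.Binary.Permutation.Propositional as Perm using (_↭_; prep; swap; ↭-refl; ↭-sym; ↭-trans; ↭-reflexive)
open import Data.List.Relation.Binary.Permutation.Propositional.Properties using (shift; ∈-resp-↭; All-resp-↭; ↭-length; ++⁺; ++⁺ˡ; ++⁺ʳ; ++-commutativeMonoid)
open import Data.Maybe using (just)
open import Data.Product using (∃; ∃₂; _×_; _,_; proj₁; proj₂)
open import Data.Sum using (_⊎_; inj₁; inj₂; [_,_]′)
open import Data.Empty using (⊥; ⊥-elim)
open import Data.Unit using (tt)
open import Data.Vec using (lookup; []; _∷_)
open import Data.Vec.Properties using (lookup⇒[]=; []=⇒lookup)
open import Function using (_∘_; flip; id)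
open import Relation.Nullary using (¬_; Dec; yes; no; contradiction)
open import Relation.Nullary.Decidable using (⌊_⌋; toWitness; fromWitness; from-no; _×-dec_; ¬?)
open import Relation.Binary.PropositionalEquality using (_≡_; _≢_; refl; sym; trans; cong; cong₂; subst; subst₂; module ≡-Reasoning)

-- Counting in lists

+-interchange : ∀ a b c d → (a + b) + (c + d) ≡ (a + c) + (b + d)
+-interchange = solve-∀

bit : Bool → ℕ
bit true  = 1
bit false = 0

bit≤1 : ∀ b → bit b ≤ 1
bit≤1 true  = ≤-refl
bit≤1 false = z≤n

bit-T : ∀ {b} → T b → bit b ≡ 1
bit-T {true} _ = refl

bit-¬T : ∀ {b} → ¬ T b → bit b ≡ 0
bit-¬T {true}  h = ⊥-elim (h tt)
bit-¬T {false} _ = refl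

T-bit : ∀ {b} → 1 ≤ bit b → T b
T-bit {true} _ = tt

bit-mono : ∀ {b c} → (T b → T c) → bit b ≤ bit c
bit-mono {true}  h = ≤-reflexive (sym (bit-T (h tt)))
bit-mono {false} h = z≤n

T-∧⁺ : ∀ {b c} → T b → T c → T (b ∧ c)
T-∧⁺ {true} _ tc = tc

T-∧⁻ : ∀ {b c} → T (b ∧ c) → T b × T c
T-∧⁻ {true} tc = tt , tc

module _ {B : Set} where

  count : (B → Bool) → List B → ℕ
  count f []      = 0
  count f (v ∷ L) = bit (f v) + count f L

  count-++ : ∀ f L M → count f (L ++ M) ≡ count f L + count f M
  count-++ f []      M = refl
  count-++ f (v ∷ L) M = trans (cong (bit (f v) +_) (count-++ f L M)) (sym (+-assoc (bit (f v)) _ _))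

  swap-+ : ∀ a b c → a + (b + c) ≡ b + (a + c)
  swap-+ = solve-∀

  count-↭ : ∀ f {L M} → L ↭ M → count f L ≡ count f M
  count-↭ f Perm.refl        = refl
  count-↭ f (prep v p)    = cong (bit (f v) +_) (count-↭ f p)
  count-↭ f (swap u v p)  =
    trans (swap-+ (bit (f u)) (bit (f v)) _) (cong (λ c → bit (f v) + (bit (f u) + c)) (count-↭ f p))
  count-↭ f (Perm.trans p q) = trans (count-↭ f p) (count-↭ f q)

  count≤length : ∀ f L → count f L ≤ length L
  count≤length f []      = z≤n
  count≤length f (v ∷ L) = +-mono-≤ (bit≤1 (f v)) (count≤length f L)

  count-mono : ∀ {f g} L → (∀ {v} → v ∈ L → T (f v) → T (g v)) → count f L ≤ count g L
  count-mono []      h = z≤n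
  count-mono (v ∷ L) h = +-mono-≤ (bit-mono (h (here refl))) (count-mono L (h ∘ there))

  count-all : ∀ {f} L → (∀ {v} → v ∈ L → T (f v)) → count f L ≡ length L
  count-all []      h = refl
  count-all (v ∷ L) h = cong₂ _+_ (bit-T (h (here refl))) (count-all L (h ∘ there))

  count-none : ∀ {f} L → (∀ {v} → v ∈ L → ¬ T (f v)) → count f L ≡ 0
  count-none []      h = refl
  count-none (v ∷ L) h = cong₂ _+_ (bit-¬T (h (here refl))) (count-none L (h ∘ there))

  count-full : ∀ {f} L → length L ≤ count f L → ∀ {v} → v ∈ L → T (f v)
  count-full {f} (u ∷ L) h v∈ with f u in eq
  count-full {f} (u ∷ L) h (here refl)     | true  = subst T (sym eq) tt
  count-full {f} (u ∷ L) (s≤s h) (there v∈) | true  = count-full L h v∈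
  count-full {f} (u ∷ L) h v∈              | false = contradiction (≤-trans h (count≤length f L)) (<-irrefl refl)

  count-pos : ∀ {f} L → 1 ≤ count f L → ∃ λ v → v ∈ L × T (f v)
  count-pos {f} (u ∷ L) h with f u in eq
  ... | true  = u , here refl , subst T (sym eq) tt
  ... | false with count-pos L h
  ...   | v , v∈ , fv = v , there v∈ , fv

  count-miss : ∀ {f} L → count f L < length L → ∃ λ v → v ∈ L × ¬ T (f v)
  count-miss {f} (u ∷ L) lt with f u in eq
  ... | false = u , here refl , subst T eq
  ... | true with count-miss L (≤-pred lt)
  ...   | v , v∈ , ¬fv = v , there v∈ , ¬fv

  count-zero : ∀ {f} L → count f L ≤ 0 → ∀ {v} → v ∈ L → ¬ T (f v)
  count-zero {f} (u ∷ L) h (here refl) fu with f u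
  count-zero {f} (u ∷ L) () (here refl) fu | true
  count-zero {f} (u ∷ L) h (there v∈) fv = count-zero L (≤-trans (m≤n+m _ (bit (f u))) h) v∈ fv

  ∈-pos : ∀ {f} L {v} → v ∈ L → T (f v) → 1 ≤ count f L
  ∈-pos {f} (u ∷ L) (here refl) fv = ≤-trans (≤-reflexive (sym (bit-T fv))) (m≤m+n _ _)
  ∈-pos {f} (u ∷ L) (there v∈) fv  = ≤-trans (∈-pos L v∈ fv) (m≤n+m _ (bit (f u)))

  -- Along a list in which no p-vertex precedes a q-vertex, only one vertex is counted twice.
  count-ordered : ∀ {p q : B → Bool} L →
    (∀ G u M v H → L ≡ G ++ u ∷ M ++ v ∷ H → T (p u) → ¬ T (q v)) →
    count p L + count q L ≤ suc (length L)
  count-ordered [] h = z≤n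
  count-ordered {p} {q} (u ∷ L) h with T? (p u)
  ... | yes pu = begin
          bit (p u) + count p L + (bit (q u) + count q L)
            ≡⟨ cong (λ c → bit (p u) + count p L + (bit (q u) + c)) qL≡0 ⟩
          bit (p u) + count p L + (bit (q u) + 0)
            ≤⟨ +-mono-≤ (+-mono-≤ (bit≤1 (p u)) (count≤length p L)) (+-monoˡ-≤ 0 (bit≤1 (q u))) ⟩
          suc (length L) + 1
            ≡⟨ +-comm _ 1 ⟩
          suc (suc (length L)) ∎
    where
    open ≤-Reasoning
    qL≡0 : count q L ≡ 0
    qL≡0 = count-none L λ v∈ → let M , H , eq = ∈-∃++ v∈ in h [] u M _ H (cong (u ∷_) eq) pu
  ... | no ¬pu = begin
          bit (p u) + count p L + (bit (q u) + count q L)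
            ≡⟨ cong (λ c → c + count p L + (bit (q u) + count q L)) (bit-¬T ¬pu) ⟩
          count p L + (bit (q u) + count q L)
            ≡⟨ swap-+ (count p L) (bit (q u)) _ ⟩
          bit (q u) + (count p L + count q L)
            ≤⟨ +-mono-≤ (bit≤1 (q u)) (count-ordered L λ G u′ M v H eq → h (u ∷ G) u′ M v H (cong (u ∷_) eq)) ⟩
          suc (suc (length L)) ∎
    where open ≤-Reasoning

  -- Permutation, distinctness and splitting of lists

  ∈⇒↭ : ∀ {v : B} {L} → v ∈ L → ∃ λ M → L ↭ v ∷ M
  ∈⇒↭ v∈ with ∈-∃++ v∈
  ... | G , H , refl = G ++ H , shift _ G H

  Unique-↭ : ∀ {L M : List B} → L ↭ M → Unique L → Unique M
  Unique-↭ Perm.refl          u       = u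
  Unique-↭ (prep v p)         (h ∷ u) = All-resp-↭ p h ∷ Unique-↭ p u
  Unique-↭ (swap v w p) ((ne ∷ h) ∷ h′ ∷ u) =
    ((ne ∘ sym) ∷ All-resp-↭ p h′) ∷ All-resp-↭ p h ∷ Unique-↭ p u
  Unique-↭ (Perm.trans p q)   u       = Unique-↭ q (Unique-↭ p u)

  Unique-++ˡ : ∀ (L : List B) {M} → Unique (L ++ M) → Unique L
  Unique-++ˡ []      u        = []
  Unique-++ˡ (v ∷ L) (h ∷ u) = All.tabulate (λ w∈ → All.lookup h (∈-++⁺ˡ w∈)) ∷ Unique-++ˡ L u

  Unique-++ʳ : ∀ (L : List B) {M} → Unique (L ++ M) → Unique M
  Unique-++ʳ []      u       = u
  Unique-++ʳ (v ∷ L) (_ ∷ u) = Unique-++ʳ L u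

  Unique-disjoint : ∀ (L : List B) {M} → Unique (L ++ M) → ∀ {u v} → u ∈ L → v ∈ M → u ≢ v
  Unique-disjoint (w ∷ L) (h ∷ u) (here refl) v∈ = All.lookup h (∈-++⁺ʳ L v∈)
  Unique-disjoint (w ∷ L) (h ∷ u) (there u∈) v∈  = Unique-disjoint L u u∈ v∈

  split-by : ∀ (f : B → Bool) L → ∃₂ λ M N → L ↭ M ++ N × (∀ {v} → v ∈ M → ¬ T (f v)) × (∀ {v} → v ∈ N → T (f v))
  split-by f []      = [] , [] , ↭-refl , (λ ()) , λ ()
  split-by f (v ∷ L) with split-by f L | T? (f v)
  ... | M , N , σ , hM , hN | yes fv = M , v ∷ N , ↭-trans (prep v σ) (↭-sym (shift v M N)) , hM , λ { (here refl) → fv ; (there w∈) → hN w∈ }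
  ... | M , N , σ , hM , hN | no ¬fv = v ∷ M , N , prep v σ , (λ { (here refl) → ¬fv ; (there w∈) → hM w∈ }) , hN

  any⊎none : ∀ (f : B → Bool) L → (∃ λ v → v ∈ L × T (f v)) ⊎ (∀ v → v ∈ L → ¬ T (f v))
  any⊎none f []      = inj₂ λ _ ()
  any⊎none f (v ∷ L) with T? (f v) | any⊎none f L
  ... | yes fv | _                    = inj₁ (v , here refl , fv)
  ... | no ¬fv | inj₁ (w , w∈ , fw) = inj₁ (w , there w∈ , fw)
  ... | no ¬fv | inj₂ none            = inj₂ λ { _ (here refl) → ¬fv ; _ (there w∈) → none _ w∈ }

  count-disjoint : ∀ {f g : B → Bool} L → (∀ {v} → v ∈ L → T (f v) → ¬ T (g v)) → count f L + count g L ≤ length L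
  count-disjoint []      h = z≤n
  count-disjoint {f} {g} (v ∷ L) h =
    ≤-trans (≤-reflexive (+-interchange (bit (f v)) (count f L) (bit (g v)) (count g L)))
      (+-mono-≤ head (count-disjoint L (h ∘ there)))
    where
    head : bit (f v) + bit (g v) ≤ 1
    head with T? (f v)
    ... | yes fv = ≤-trans (≤-reflexive (cong (bit (f v) +_) (bit-¬T (h (here refl) fv)))) (≤-trans (≤-reflexive (+-identityʳ _)) (bit≤1 (f v)))
    ... | no ¬fv = ≤-trans (≤-reflexive (cong (_+ bit (g v)) (bit-¬T ¬fv))) (bit≤1 (g v))

-- Rearrangements of concatenated lists

module CMS {B : Set} where
  open import Algebra.Solver.CommutativeMonoid (++-commutativeMonoid {A = B}) public using (solve; _⊜_; _⊕_) renaming (id to ε)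

module Shuffle {B : Set} where
  open CMS {B}

  shuffle-opposite : ∀ (H P Q D : List B) → (H ++ P ++ Q) ++ D ↭ (H ++ Q ++ P) ++ D
  shuffle-opposite = solve 4 (λ h p q d → (h ⊕ (p ⊕ q)) ⊕ d ⊜ (h ⊕ (q ⊕ p)) ⊕ d) ↭-refl

  shuffle-assoc : ∀ (H P R S : List B) → (H ++ P) ++ R ++ S ↭ (H ++ P ++ R) ++ S
  shuffle-assoc = solve 4 (λ h p r s → (h ⊕ p) ⊕ (r ⊕ s) ⊜ (h ⊕ (p ⊕ r)) ⊕ s) ↭-refl

  -- For `cross`: two paths are cut as `G ++ E` and `E′ ++ H`; the new route is `G`, `R`, `H`, and
  -- `E`, `E′` are left over.
  shuffle-cross : ∀ (G E E′ H R : List B) → ((G ++ E) ++ (E′ ++ H)) ++ R ↭ ((G ++ R ++ H) ++ E) ++ E′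
  shuffle-cross = solve 5 (λ g e e′ h r → ((g ⊕ e) ⊕ (e′ ⊕ h)) ⊕ r ⊜ ((g ⊕ (r ⊕ h)) ⊕ e) ⊕ e′) ↭-refl

  shuffle-along : ∀ (G u M v H Q R : List B) → ((G ++ u ++ M ++ v ++ H) ++ Q) ++ R ↭ (R ++ M) ++ (G ++ u ++ v ++ H) ++ Q
  shuffle-along = solve 7 (λ g u m v h q r → ((g ⊕ (u ⊕ (m ⊕ (v ⊕ h)))) ⊕ q) ⊕ r ⊜ (r ⊕ m) ⊕ ((g ⊕ (u ⊕ (v ⊕ h))) ⊕ q)) ↭-refl

  shuffle-back : ∀ (G u N v H Q : List B) → N ++ (G ++ u ++ v ++ H) ++ Q ↭ (G ++ u ++ N ++ v ++ H) ++ Q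
  shuffle-back = solve 6 (λ g u m v h q → m ⊕ ((g ⊕ (u ⊕ (v ⊕ h))) ⊕ q) ⊜ (g ⊕ (u ⊕ (m ⊕ (v ⊕ h)))) ⊕ q) ↭-refl

  shuffle-left : ∀ (K I E : List B) → K ++ I ++ E ↭ I ++ K ++ E
  shuffle-left = solve 3 (λ k i e → k ⊕ (i ⊕ e) ⊜ i ⊕ (k ⊕ e)) ↭-refl

  shuffle-release : ∀ (H a as a′ bs D : List B) → (H ++ (a ++ as) ++ (a′ ++ bs)) ++ D ↭ (H ++ a ++ as ++ bs) ++ (a′ ++ D)
  shuffle-release = solve 6 (λ h a as a′ bs d → (h ⊕ ((a ⊕ as) ⊕ (a′ ⊕ bs))) ⊕ d ⊜ (h ⊕ (a ⊕ (as ⊕ bs))) ⊕ (a′ ⊕ d)) ↭-refl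

  shuffle-insert : ∀ (H a as bs R R′ : List B) → (H ++ a ++ as ++ bs) ++ (R ++ R′) ↭ (H ++ a ++ (R ++ bs) ++ as) ++ R′
  shuffle-insert = solve 6 (λ h a as bs r r′ → (h ⊕ (a ⊕ (as ⊕ bs))) ⊕ (r ⊕ r′) ⊜ (h ⊕ (a ⊕ ((r ⊕ bs) ⊕ as))) ⊕ r′) ↭-refl

  shuffle-swap : ∀ (M N : List B) → M ++ N ↭ N ++ M
  shuffle-swap = solve 2 (λ m n → m ⊕ n ⊜ n ⊕ m) ↭-refl

  shuffle-pair : ∀ (H U Q p A q A′ R : List B) →
    H ++ (U ++ Q) ++ (p ++ A) ++ (q ++ A′) ++ R ↭ (H ++ Q ++ p ++ q) ++ (U ++ A ++ A′ ++ R)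
  shuffle-pair = solve 8 (λ h u q p a q′ a′ r → h ⊕ ((u ⊕ q) ⊕ ((p ⊕ a) ⊕ ((q′ ⊕ a′) ⊕ r))) ⊜ (h ⊕ (q ⊕ (p ⊕ q′))) ⊕ (u ⊕ (a ⊕ (a′ ⊕ r)))) ↭-refl

  shuffle-triple : ∀ (H U Q p A q A′ v R : List B) →
    H ++ (U ++ Q) ++ (p ++ A) ++ (q ++ A′) ++ (v ++ R) ↭ (H ++ Q ++ p ++ v ++ q) ++ (U ++ A ++ A′ ++ R)
  shuffle-triple = solve 9 (λ h u q p a q′ a′ v r → h ⊕ ((u ⊕ q) ⊕ ((p ⊕ a) ⊕ ((q′ ⊕ a′) ⊕ (v ⊕ r)))) ⊜ (h ⊕ (q ⊕ (p ⊕ (v ⊕ q′)))) ⊕ (u ⊕ (a ⊕ (a′ ⊕ r)))) ↭-refl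

  shuffle-into-U : ∀ (H c U Q p A A′ R : List B) →
    H ++ ((c ++ U) ++ Q) ++ (p ++ A) ++ A′ ++ R ↭ (H ++ Q ++ p ++ c) ++ (U ++ A ++ A′ ++ R)
  shuffle-into-U = solve 8 (λ h c u q p a a′ r → h ⊕ (((c ⊕ u) ⊕ q) ⊕ ((p ⊕ a) ⊕ (a′ ⊕ r))) ⊜ (h ⊕ (q ⊕ (p ⊕ c))) ⊕ (u ⊕ (a ⊕ (a′ ⊕ r)))) ↭-refl

  shuffle-from-U : ∀ (H c U Q A q A′ R : List B) →
    H ++ ((c ++ U) ++ Q) ++ A ++ (q ++ A′) ++ R ↭ (H ++ Q ++ c ++ q) ++ (U ++ A ++ A′ ++ R)
  shuffle-from-U = solve 8 (λ h c u q a q′ a′ r → h ⊕ (((c ⊕ u) ⊕ q) ⊕ (a ⊕ ((q′ ⊕ a′) ⊕ r))) ⊜ (h ⊕ (q ⊕ (c ⊕ q′))) ⊕ (u ⊕ (a ⊕ (a′ ⊕ r)))) ↭-refl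

  shuffle-exchange : ∀ (H U a b p A q A′ R : List B) →
    H ++ (U ++ a ++ b) ++ (p ++ A) ++ (q ++ A′) ++ R ↭ (H ++ (p ++ b) ++ (a ++ q)) ++ (U ++ A ++ A′ ++ R)
  shuffle-exchange = solve 9 (λ h u a b p c q d r → h ⊕ ((u ⊕ (a ⊕ b)) ⊕ ((p ⊕ c) ⊕ ((q ⊕ d) ⊕ r))) ⊜ (h ⊕ ((p ⊕ b) ⊕ (a ⊕ q))) ⊕ (u ⊕ (c ⊕ (d ⊕ r)))) ↭-refl

  shuffle-arc : ∀ (H U a A b A′ R : List B) →
    H ++ U ++ (a ++ A) ++ (b ++ A′) ++ R ↭ H ++ (U ++ a ++ b) ++ A ++ A′ ++ R
  shuffle-arc = solve 7 (λ h u a c b d r → h ⊕ (u ⊕ ((a ⊕ c) ⊕ ((b ⊕ d) ⊕ r))) ⊜ h ⊕ ((u ⊕ (a ⊕ b)) ⊕ (c ⊕ (d ⊕ r)))) ↭-refl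

  shuffle-arc₂ : ∀ (H U a A b A′ v R : List B) →
    H ++ U ++ (a ++ A) ++ (b ++ A′) ++ (v ++ R) ↭ H ++ (U ++ a ++ v ++ b) ++ A ++ A′ ++ R
  shuffle-arc₂ = solve 8 (λ h u a c b d v r → h ⊕ (u ⊕ ((a ⊕ c) ⊕ ((b ⊕ d) ⊕ (v ⊕ r)))) ⊜ h ⊕ ((u ⊕ (a ⊕ (v ⊕ b))) ⊕ (c ⊕ (d ⊕ r)))) ↭-refl

  shuffle-classes : ∀ (H Z Y X U : List B) → H ++ ((Z ++ Y) ++ (X ++ U)) ↭ H ++ U ++ X ++ Y ++ Z
  shuffle-classes = solve 5 (λ h z y x u → h ⊕ ((z ⊕ y) ⊕ (x ⊕ u)) ⊜ h ⊕ (u ⊕ (x ⊕ (y ⊕ z)))) ↭-refl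

open Shuffle

-- Walks in a tournament and their merging

module Tournament {m : ℕ} (A : Digraph m) (tour : IsTournament A) where

  open IsTournament tour

  V : Set
  V = Fin m

  infix 4 _⟶_
  _⟶_ : V → V → Set
  u ⟶ v = T (A u v)

  _⟶?_ : ∀ u v → Dec (u ⟶ v)
  u ⟶? v = T? (A u v)

  ⟶-irrefl : ∀ {u} → ¬ u ⟶ u
  ⟶-irrefl {u} = subst (¬_ ∘ T) (sym (irreflexive u)) id

  ⟶⇒≢ : ∀ {u v} → u ⟶ v → u ≢ v
  ⟶⇒≢ uv refl = ⟶-irrefl uv

  ⟶-asym : ∀ {u v} → u ⟶ v → ¬ v ⟶ u
  ⟶-asym {u} {v} uv vu = go (A u v) (A v u) (exactly-one u v (⟶⇒≢ uv)) uv vu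
    where
    go : ∀ b c → b ≡ not c → T b → ¬ T c
    go true true () _ _

  ⟶-connex : ∀ {u v} → u ≢ v → ¬ u ⟶ v → v ⟶ u
  ⟶-connex {u} {v} u≢v ¬uv with A u v | A v u | exactly-one u v u≢v
  ... | true  | _    | _ = ⊥-elim (¬uv tt)
  ... | false | true | _ = tt

  ⟶-total : ∀ {u v} → u ≢ v → u ⟶ v ⊎ v ⟶ u
  ⟶-total {u} {v} u≢v with u ⟶? v
  ... | yes uv = inj₁ uv
  ... | no ¬uv = inj₂ (⟶-connex u≢v ¬uv)

  -- Seg u L v : a walk from u to v with interior L.
  -- Fro u L v : a walk from u to v, L listing what follows u.
  -- To  u L v : a walk from u to v, L listing what precedes v.
  Seg : V → List V → V → Set
  Seg u []      v = u ⟶ v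
  Seg u (w ∷ L) v = u ⟶ w × Seg w L v

  data Fro : V → List V → V → Set where
    stop : ∀ {u} → Fro u [] u
    step : ∀ {u w L v} → u ⟶ w → Fro w L v → Fro u (w ∷ L) v

  data To : V → List V → V → Set where
    stop : ∀ {v} → To v [] v
    step : ∀ {u w L v} → u ⟶ w → To w L v → To u (u ∷ L) v

  seg-++ : ∀ {u w v} L {M} → Seg u L w → Seg w M v → Seg u (L ++ w ∷ M) v
  seg-++ []      s        s′ = s , s′
  seg-++ (_ ∷ L) (a , s) s′ = a , seg-++ L s s′

  seg-split : ∀ {u w v} L {M} → Seg u (L ++ w ∷ M) v → Seg u L w × Seg w M v
  seg-split []      (a , s) = a , s
  seg-split (_ ∷ L) (a , s) = let s₁ , s₂ = seg-split L s in (a , s₁) , s₂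

  fro-seg : ∀ {u p v G L} → Fro u G p → Seg p L v → Seg u (G ++ L) v
  fro-seg stop       s = s
  fro-seg (step a f) s = a , fro-seg f s

  fro-fro : ∀ {u p v G L} → Fro u G p → Fro p L v → Fro u (G ++ L) v
  fro-fro stop       g = g
  fro-fro (step a f) g = step a (fro-fro f g)

  to-seg : ∀ {p q v H} → p ⟶ q → To q H v → Seg p H v
  to-seg a stop        = a
  to-seg a (step b t) = a , to-seg b t

  seg-to : ∀ {p q v} R {H} → Seg p R q → To q H v → Seg p (R ++ H) v
  seg-to []      a       t = to-seg a t
  seg-to (_ ∷ R) (a , s) t = a , seg-to R s t

  -- Admitting `x` as `p`, and `y` as `q` in `seg-into`, lets the common endpoints take part in
  -- links between two paths.
  seg-from : ∀ {x y p} L → Seg x L y → p ∈ x ∷ L →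
    ∃₂ λ G E → L ≡ G ++ E × Fro x G p × Seg p E y
  seg-from L       s       (here refl) = [] , L , refl , stop , s
  seg-from (w ∷ L) (a , s) (there p∈) with seg-from L s p∈
  ... | G , E , refl , f , s′ = w ∷ G , E , refl , step a f , s′

  seg-into : ∀ {x y q} L → Seg x L y → q ∈ L ++ [ y ] →
    ∃₂ λ E H → L ≡ E ++ H × Seg x E q × To q H y
  seg-into []      a       (here refl) = [] , [] , refl , a , stop
  seg-into (w ∷ L) (a , s) (here refl) = [] , w ∷ L , refl , a , seg⇒to L s
    where
    seg⇒to : ∀ {u v} L → Seg u L v → To u (u ∷ L) v
    seg⇒to []      a       = step a stop
    seg⇒to (_ ∷ L) (a , s) = step a (seg⇒to L s)
  seg-into (w ∷ L) (a , s) (there q∈) with seg-into L s q∈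
  ... | E , H , refl , s′ , t = w ∷ E , H , refl , (a , s′) , t

  -- As in merge sort, the winner of the arc between the two front vertices comes next. The vertex
  -- placed last then beats both remaining fronts, and once one list is used up, the other still
  -- leads to `v`.
  merge : ∀ {u v} G E → Unique (G ++ E) → Seg u G v → Seg u E v →
    ∃ λ N → N ↭ G ++ E × Seg u N v
  merge []      E _ s s′ = E , ↭-refl , s′
  merge {v = v} (g ∷ G) E un (a , s) s′ = go E un a s′
    where
    go : ∀ {u} E → Unique ((g ∷ G) ++ E) → u ⟶ g → Seg u E v → ∃ λ N → N ↭ (g ∷ G) ++ E × Seg u N v
    go []      _ a _ = g ∷ G , ↭-reflexive (sym (++-identityʳ≡ (g ∷ G))) , a , s
    go (e ∷ E) un@(g∉ ∷ un′) a (a′ , s′) with g ⟶? e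
    ... | yes ge with merge G (e ∷ E) un′ s (ge , s′)
    ...   | N , p , t = g ∷ N , prep g p , a , t
    go (e ∷ E) un@(g∉ ∷ un′) a (a′ , s′) | no ¬ge
      with go E (Unique-++ʳ [ e ] (Unique-↭ (shift e (g ∷ G) E) un))
             (⟶-connex (All.lookup g∉ (∈-++⁺ʳ G (here refl))) ¬ge) s′
    ... | N , p , t = e ∷ N , ↭-trans (prep e p) (↭-sym (shift e (g ∷ G) E)) , a′ , t

  insert-after : ∀ {x y p} M E → Unique (M ++ E) → Seg x M y → p ∈ x ∷ M → Seg p E y →
    ∃ λ N → N ↭ M ++ E × Seg x N y
  insert-after M E un s p∈ e with seg-from M s p∈
  ... | G , M′ , refl , f , s′ with merge M′ E (Unique-++ʳ G (subst Unique (++-assoc≡ G M′ E) un)) s′ e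
  ...   | N , p , t = G ++ N , ↭-trans (++⁺ˡ G p) (↭-reflexive (sym (++-assoc≡ G M′ E))) , fro-seg f t

  insert-before : ∀ {x y q} M E → Unique (M ++ E) → Seg x M y → q ∈ M ++ [ y ] → Seg x E q →
    ∃ λ N → N ↭ M ++ E × Seg x N y
  insert-before M E un s q∈ e with seg-into M s q∈
  ... | M′ , H , refl , s′ , t
    with merge M′ E (Unique-++ˡ (M′ ++ E) (Unique-↭ perm un)) s′ e
    where
    open CMS
    perm : (M′ ++ H) ++ E ↭ (M′ ++ E) ++ H
    perm = solve 3 (λ a b c → (a ⊕ b) ⊕ c ⊜ (a ⊕ c) ⊕ b) ↭-refl M′ H E
  ... | N , p , u = N ++ H , ↭-trans (++⁺ʳ H p) perm , seg-to N u t
    where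
    open CMS
    perm : (M′ ++ E) ++ H ↭ (M′ ++ H) ++ E
    perm = solve 3 (λ a b c → (a ⊕ c) ⊕ b ⊜ (a ⊕ b) ⊕ c) ↭-refl M′ H E

  fro-ends : ∀ {u L v} → Fro u L v → v ∈ u ∷ L
  fro-ends stop       = here refl
  fro-ends (step _ f) = there (fro-ends f)

  fro-step : ∀ {u L v w} → Fro u L v → v ⟶ w → Seg u L w
  fro-step stop       b = b
  fro-step (step a f) b = a , fro-step f b

  seg-fro : ∀ {u v} L → Seg u L v → ∃ λ w → Fro u L w × w ⟶ v
  seg-fro []      a       = _ , stop , a
  seg-fro (_ ∷ L) (a , s) = let w , f , b = seg-fro L s in w , step a f , b

  fro-split : ∀ {u v} G {H} → Fro u (G ++ H) v → ∃ λ w → Fro u G w × Fro w H v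
  fro-split []      f          = _ , stop , f
  fro-split (_ ∷ G) (step a f) = let w , g , h = fro-split G f in w , step a g , h

  -- Cycles, Hamiltonian paths and the initial strong component

  Cycle : V → List V → Set
  Cycle c C = Seg c C c

  rotate-to : ∀ {c d} C → Cycle c C → d ∈ c ∷ C → ∃ λ E → c ∷ C ↭ d ∷ E × Cycle d E
  rotate-to C s (here refl) = C , ↭-refl , s
  rotate-to {c} {d} C s (there d∈) with ∈-∃++ d∈
  ... | G , H , refl with seg-split G s
  ...   | s₁ , s₂ = H ++ c ∷ G , solve 4 (λ a b x y → a ⊕ (b ⊕ (x ⊕ y)) ⊜ x ⊕ (y ⊕ (a ⊕ b))) ↭-refl [ c ] G [ d ] H , seg-++ H s₂ s₁
    where open CMS

  -- Rédei's theorem by insertion: if the new vertex does not beat the first one, it goes directly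
  -- before the first vertex that it beats, or to the end.
  hamiltonian-path : ∀ v L → Unique (v ∷ L) → ∃₂ λ h H → v ∷ L ↭ h ∷ H × ∃ (Fro h H)
  hamiltonian-path v []      un = v , [] , ↭-refl , v , stop
  hamiltonian-path v (w ∷ L) (v∉ ∷ un) with hamiltonian-path w L un
  ... | h , H , p , z , f with v ⟶? h
  ...   | yes vh = v , h ∷ H , prep v p , z , step vh f
  ...   | no ¬vh with insert H f (⟶-connex (All.lookup v∉h (here refl)) ¬vh) (All.tail v∉h)
    where
    v∉h = All-resp-↭ p v∉
    insert : ∀ {h z} H → Fro h H z → h ⟶ v → All (v ≢_) H → ∃ λ H′ → v ∷ H ↭ H′ × ∃ (Fro h H′)
    insert []      f          a _  = [ v ] , ↭-refl , v , step a stop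
    insert (w ∷ H) (step b f) a (v≢w ∷ ne) with v ⟶? w
    ... | yes vw = v ∷ w ∷ H , ↭-refl , _ , step a (step vw f)
    ... | no ¬vw with insert H f (⟶-connex v≢w ¬vw) ne
    ...   | H′ , q , z′ , g = w ∷ H′ , ↭-trans (swap v w ↭-refl) (prep w q) , z′ , step b g
  ...     | H′ , q , z′ , g = h , H′ , ↭-trans (prep v p) (↭-trans (swap v h ↭-refl) (prep h q)) , z′ , g

  -- Started at `u`, the cycle is followed as long as its vertices beat `v`. This stops at `w` at
  -- the latest, and `v` fits in just before the stopping vertex.
  cycle-insert : ∀ {c u w} C v → Cycle c C → All (v ≢_) (c ∷ C) → u ∈ c ∷ C → u ⟶ v → w ∈ c ∷ C → v ⟶ w →
    ∃₂ λ d E → v ∷ c ∷ C ↭ d ∷ E × Cycle d E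
  cycle-insert {c} {u} {w} C v s v∉ u∈ uv w∈ vw with rotate-to C s u∈
  ... | E , p , t with go E (All.tail (All-resp-↭ p v∉)) t uv (tail∈ (∈-resp-↭ p w∈))
    where
    tail∈ : ∀ {E} → w ∈ u ∷ E → w ∈ E
    tail∈ (here refl) = ⊥-elim (⟶-asym uv vw)
    tail∈ (there w∈)  = w∈
    go : ∀ {h z} E → All (v ≢_) E → Seg h E z → h ⟶ v → w ∈ E → ∃ λ E′ → v ∷ E ↭ E′ × Seg h E′ z
    go (e ∷ E) (v≢e ∷ ne) (a , s) hv w∈ with v ⟶? e
    ... | yes ve = v ∷ e ∷ E , ↭-refl , hv , ve , s
    go (e ∷ E) (v≢e ∷ ne) (a , s) hv (here refl) | no ¬ve = ⊥-elim (¬ve vw)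
    go (e ∷ E) (v≢e ∷ ne) (a , s) hv (there w∈)  | no ¬ve with go E ne s (⟶-connex v≢e ¬ve) w∈
    ... | E′ , q , s′ = e ∷ E′ , ↭-trans (swap v e ↭-refl) (prep e q) , a , s′
  ... | E′ , q , t′ = u , E′ , ↭-trans (prep v p) (↭-trans (swap v u ↭-refl) (prep u q)) , t′

  -- I is the initial strong component of D.
  record Initial (D : List V) : Set where
    field
      {first}  : V
      others   : List V
      E        : List V
      perm     : D ↭ (first ∷ others) ++ E
      strong   : others ≡ [] ⊎ Cycle first others
      dominate : ∀ {u v} → u ∈ first ∷ others → v ∈ E → u ⟶ v
    I : List V
    I = first ∷ others

  -- Because the back arc is the first one, `C` dominates the stretch `E₁` before it, so a cycle can
  -- run from any vertex of `C` into that stretch.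
  first-back-arc : ∀ C E → (∀ {u v} → u ∈ C → v ∈ E → u ≢ v) →
    (∀ {u v} → u ∈ C → v ∈ E → u ⟶ v) ⊎
    ∃₂ λ E₁ v → ∃₂ λ E₂ c → E ≡ E₁ ++ v ∷ E₂ × (∀ {u w} → u ∈ C → w ∈ E₁ → u ⟶ w) × c ∈ C × v ⟶ c
  first-back-arc C []      ne = inj₁ λ _ ()
  first-back-arc C (v ∷ E) ne with Any.any? (v ⟶?_) C
  ... | yes back = let c , c∈ , vc = find′ back in
          inj₂ ([] , v , E , c , refl , (λ _ ()) , c∈ , vc)
    where
    find′ : ∀ {C} → Any (v ⟶_) C → ∃ λ c → c ∈ C × v ⟶ c
    find′ (here px) = _ , here refl , px
    find′ (there a) = let c , c∈ , vc = find′ a in c , there c∈ , vc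
  ... | no ¬back with first-back-arc C E (λ u∈ v∈ → ne u∈ (there v∈))
  ...   | inj₁ all = inj₁ λ { u∈ (here refl) → fwd u∈ ; u∈ (there v∈) → all u∈ v∈ }
    where
    fwd : ∀ {u} → u ∈ C → u ⟶ v
    fwd u∈ = ⟶-connex (ne u∈ (here refl) ∘ sym) λ vu → ¬back (Any.map (λ { refl → vu }) u∈)
  ...   | inj₂ (E₁ , w , E₂ , c , refl , all , c∈ , wc) =
          inj₂ (v ∷ E₁ , w , E₂ , c , refl , (λ { u∈ (here refl) → fwd u∈ ; u∈ (there v∈) → all u∈ v∈ }) , c∈ , wc)
    where
    fwd : ∀ {u} → u ∈ C → u ⟶ v
    fwd u∈ = ⟶-connex (ne u∈ (here refl) ∘ sym) λ vu → ¬back (Any.map (λ { refl → vu }) u∈)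

  strong-rotate : ∀ {c d} C → (C ≡ [] ⊎ Cycle c C) → d ∈ c ∷ C → ∃ λ E → c ∷ C ↭ d ∷ E × ∃ (Fro d E)
  strong-rotate .[] (inj₁ refl) (here refl) = [] , ↭-refl , _ , stop
  strong-rotate C   (inj₂ s)    d∈ with rotate-to C s d∈
  ... | E , p , t = let z , f , _ = seg-fro E t in E , p , z , f

  -- The component grows along a Hamiltonian path, from its first vertex. Invariant: it is a single
  -- vertex or carries a cycle, and the rest `E` continues as a path from one of its vertices `u`. A
  -- back arc closes a larger cycle; without one, the component dominates the rest.
  initial : ∀ v L → Unique (v ∷ L) → Initial (v ∷ L)
  initial v L un with hamiltonian-path v L un
  ... | h , H , p , z , f = transport (grow (length H) H ≤-refl [] (inj₁ refl) (Unique-↭ p un) (here refl) f)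
    where
    transport : Initial (h ∷ H) → Initial (v ∷ L)
    transport i = record { others = others ; E = E ; perm = ↭-trans p perm ; strong = strong ; dominate = dominate }
      where open Initial i
    grow : ∀ {c u z} b E → length E ≤ b → ∀ C → (C ≡ [] ⊎ Cycle c C) → Unique ((c ∷ C) ++ E) →
      u ∈ c ∷ C → Fro u E z → Initial ((c ∷ C) ++ E)
    grow {c} {u} b E E≤b C st un u∈ f
      with first-back-arc (c ∷ C) E (Unique-disjoint (c ∷ C) un)
    ... | inj₁ all = record { others = C ; E = E ; perm = ↭-refl ; strong = st ; dominate = all }
    grow {c} {u} zero .(E₁ ++ w ∷ E₂) E≤b C st un u∈ f | inj₂ (E₁ , w , E₂ , d , refl , _) =
      ⊥-elim (1+n≰n (≤-trans (≤-trans (m≤n+m 1 (length E₁)) (+-monoʳ-≤ (length E₁) (s≤s z≤n))) (≤-trans (≤-reflexive (sym (length-++ E₁))) E≤b)))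
    -- With a single vertex `c`, both `u` and `d` equal `c`, so `u ⟶ w` and `w ⟶ d` are opposite
    -- arcs.
    grow {c} {u} (suc b) .(w ∷ E₂) (s≤s E≤b) C (inj₁ refl) un u∈ (step uw f) | inj₂ ([] , w , E₂ , d , refl , all , d∈ , wd) =
      ⊥-elim (⟶-asym (subst (_⟶ w) (only u∈) uw) (subst (w ⟶_) (only d∈) wd))
      where
      only : ∀ {u} → u ∈ [ c ] → u ≡ c
      only (here refl) = refl
    grow {c} {u} (suc b) .(w ∷ E₂) (s≤s E≤b) C (inj₂ cyc) un u∈ (step uw f) | inj₂ ([] , w , E₂ , d , refl , all , d∈ , wd)
      with cycle-insert C w cyc (All.tabulate (λ v∈ → Unique-disjoint (c ∷ C) un v∈ (here refl) ∘ sym)) u∈ uw d∈ wd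
    ... | e , C′ , q , cyc′ = record { Initial i ; perm = ↭-trans pq (Initial.perm i) }
      where
      pq : (c ∷ C) ++ w ∷ E₂ ↭ (e ∷ C′) ++ E₂
      pq = ↭-trans (shift w (c ∷ C) E₂) (++⁺ʳ E₂ q)
      i : Initial ((e ∷ C′) ++ E₂)
      i = grow b E₂ E≤b C′ (inj₂ cyc′) (Unique-↭ pq un) (∈-resp-↭ q (here refl)) f
    -- The new cycle runs through the old one from `d`, jumps to `g`, which lies before the first
    -- back arc and so is dominated, follows the path up to `w` and returns to `d`.
    grow {c} {u} (suc b) .(g ∷ E₁ ++ w ∷ E₂) (s≤s E≤b) C st un u∈ (step ug f) | inj₂ (g ∷ E₁ , w , E₂ , d , refl , all , d∈ , wd)
      with strong-rotate C st d∈ | fro-split (E₁ ++ [ w ]) (subst (λ L → Fro g L _) (sym (++-assoc≡ E₁ [ w ] E₂)) f)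
    ... | C′ , q , t , f′ | w′ , f₁ , f₂ with last-is (g ∷ E₁) f₁′
      where
      f₁′ = step ug f₁
      last-is : ∀ {a b} G → Fro a (G ++ [ w ]) b → b ≡ w
      last-is []      (step _ stop) = refl
      last-is (_ ∷ G) (step _ f)    = last-is G f
    ...   | refl = record { Initial i ; perm = ↭-trans pq (Initial.perm i) }
      where
      N : List V
      N = C′ ++ g ∷ E₁ ++ [ w ]
      pq : (c ∷ C) ++ g ∷ E₁ ++ w ∷ E₂ ↭ (d ∷ N) ++ E₂
      pq = ↭-trans (++⁺ʳ (g ∷ E₁ ++ w ∷ E₂) q)
             (solve 6 (λ D c g e w f → (D ⊕ c) ⊕ (g ⊕ (e ⊕ (w ⊕ f))) ⊜ (D ⊕ (c ⊕ (g ⊕ (e ⊕ w)))) ⊕ f) ↭-refl [ d ] C′ [ g ] E₁ [ w ] E₂)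
        where open CMS
      cyc′ : Cycle d N
      cyc′ = fro-step (fro-fro f′ (step (all (∈-resp-↭ (↭-sym q) (fro-ends f′)) (here refl)) f₁)) wd
      i : Initial ((d ∷ N) ++ E₂)
      i = grow b E₂ (≤-trans (≤-trans (m≤n+m (length E₂) (suc (length E₁))) (≤-reflexive (trans (sym (+-suc (length E₁) _)) (sym (length-++ E₁))))) E≤b)
            N (inj₂ cyc′) (Unique-↭ pq un) (there (∈-++⁺ʳ C′ (there (∈-++⁺ʳ E₁ (here refl))))) f₂

  initial′ : ∀ L → 1 ≤ length L → Unique L → Initial L
  initial′ (v ∷ L) _ un = initial v L un

  -- If nothing lies outside the initial component, it is all of `D`, and two vertices exclude the
  -- trivial component.
  cycle⊎rest : ∀ {D} (i : Initial D) → 2 ≤ length D →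
    (∃₂ λ c C → D ↭ c ∷ C × Cycle c C) ⊎ 1 ≤ length (Initial.E i)
  cycle⊎rest record { E = _ ∷ _ } _ = inj₂ (s≤s z≤n)
  cycle⊎rest record { others = C ; E = [] ; perm = σ ; strong = inj₂ cyc } _ =
    inj₁ (_ , C , ↭-trans σ (↭-reflexive (++-identityʳ≡ _)) , cyc)
  cycle⊎rest record { E = [] ; perm = σ ; strong = inj₁ refl } 2≤ =
    contradiction (≤-trans 2≤ (≤-reflexive (↭-length σ))) λ { (s≤s ()) }

flip-tournament : ∀ {m} {A : Digraph m} → IsTournament A → IsTournament (flip A)
flip-tournament t = record
  { irreflexive = irreflexive ; exactly-one = λ u v u≢v → exactly-one v u (u≢v ∘ sym) }
  where open IsTournament t

-- Shifting along a cycle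

module Rotation {m : ℕ} (A : Digraph m) (tour : IsTournament A) where

  open Tournament A tour

  rot : List V → List V
  rot []      = []
  rot (c ∷ C) = C ++ [ c ]

  rots : ℕ → List V → List V
  rots zero    L = L
  rots (suc i) L = rots i (rot L)

  rots-+ : ∀ i j L → rots i (rots j L) ≡ rots (j + i) L
  rots-+ i zero    L = refl
  rots-+ i (suc j) L = rots-+ i j (rot L)

  rots-comm : ∀ i j L → rots i (rots j L) ≡ rots j (rots i L)
  rots-comm i j L = trans (rots-+ i j L) (trans (cong (λ k → rots k L) (+-comm j i)) (sym (rots-+ j i L)))

  rot-↭ : ∀ L → rot L ↭ L
  rot-↭ []      = ↭-refl
  rot-↭ (c ∷ C) = ↭-trans (shift c C []) (↭-reflexive (cong (c ∷_) (++-identityʳ≡ C)))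

  rots-↭ : ∀ i L → rots i L ↭ L
  rots-↭ zero    L = ↭-refl
  rots-↭ (suc i) L = ↭-trans (rots-↭ i (rot L)) (rot-↭ L)

  IsCycle : List V → Set
  IsCycle L = ∃₂ λ c C → L ≡ c ∷ C × Cycle c C

  rots-cycle : ∀ i {L} → IsCycle L → IsCycle (rots i L)
  rots-cycle zero    cyc = cyc
  rots-cycle (suc i) (c , []     , refl , a)     = ⊥-elim (⟶-irrefl a)
  rots-cycle (suc i) (c , d ∷ C , refl , a , s) = rots-cycle i (d , C ++ [ c ] , refl , seg-++ C s a)

  head-bit : (V → Bool) → List V → ℕ
  head-bit f []      = 0
  head-bit f (c ∷ _) = bit (f c)

  sumTo : (ℕ → ℕ) → ℕ → ℕ
  sumTo g zero    = 0
  sumTo g (suc N) = g 0 + sumTo (g ∘ suc) N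

  sumTo-cong : ∀ {g h} N → (∀ i → g i ≡ h i) → sumTo g N ≡ sumTo h N
  sumTo-cong zero    eq = refl
  sumTo-cong (suc N) eq = cong₂ _+_ (eq 0) (sumTo-cong N (eq ∘ suc))

  sumTo-pigeonhole : ∀ {g h} N → sumTo g N < sumTo h N → ∃ λ i → g i < h i
  sumTo-pigeonhole {g} {h} (suc N) lt with h 0 ≤? g 0
  ... | no  ¬le = 0 , ≰⇒> ¬le
  ... | yes le  = let i , lt′ = sumTo-pigeonhole N (+-cancelˡ-< (h 0) _ _ (≤-<-trans (+-monoˡ-≤ _ le) lt)) in suc i , lt′

  -- Rotation moves the vertices of `L` one by one behind `M`, so each of them is in front exactly
  -- once; a general `M` carries the induction.
  sumTo-heads : ∀ f L M → sumTo (λ i → head-bit f (rots i (L ++ M))) (length L) ≡ count f L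
  sumTo-heads f []      M = refl
  sumTo-heads f (v ∷ L) M = cong (bit (f v) +_)
    (trans (sumTo-cong (length L) (λ i → cong (head-bit f ∘ rots i) (++-assoc≡ L M [ v ])))
           (sumTo-heads f L (M ++ [ v ])))

  sumTo-rots : ∀ f L → sumTo (λ i → head-bit f (rots i L)) (length L) ≡ count f L
  sumTo-rots f L = trans (sumTo-cong (length L) λ i → cong (head-bit f ∘ rots i) (sym (++-identityʳ≡ L))) (sumTo-heads f L [])

  -- Ties rotation to walking: `t` rotations bring to the front the vertex reached after `t` steps.
  -- `M` collects what has been moved to the back.
  initial-segment : ∀ t {u z} U M → t ≤ length U → Fro u U z →
    ∃₂ λ R R′ → ∃₂ λ w L → U ≡ R ++ R′ × length R ≡ t × Fro u R w × rots t (u ∷ U ++ M) ≡ w ∷ L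
  initial-segment zero    {u} U M le f = [] , U , u , U ++ M , refl , refl , stop , refl
  initial-segment (suc t) {u} (v ∷ U) M (s≤s le) (step a f) with initial-segment t U (M ++ [ u ]) le f
  ... | R , R′ , w , L , eq , len , g , r =
    v ∷ R , R′ , w , L , cong (v ∷_) eq , cong suc len , step a g ,
    trans (cong (rots t ∘ (v ∷_)) (++-assoc≡ U M [ u ])) r

  -- Averaging over all rotations: the front vertices satisfy `f` more often than the vertices `t`
  -- places further on satisfy `g`, so some rotation has the first property without the second.
  cycle-window : ∀ {c C f g} t → Cycle c C → t ≤ length C → count g (c ∷ C) < count f (c ∷ C) →
    ∃₂ λ u R → ∃₂ λ R′ w → c ∷ C ↭ (u ∷ R) ++ R′ × length R ≡ t × Fro u R w × T (f u) × ¬ T (g w)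
  cycle-window {c} {C} {f} {g} t cyc le lt
    with sumTo-pigeonhole (length L) (subst₂ _<_ (sym shifted) (sym (sumTo-rots f L)) lt)
    where
    L : List V
    L = c ∷ C
    shifted : sumTo (λ i → head-bit g (rots i (rots t L))) (length L) ≡ count g L
    shifted = trans (cong (sumTo _) (sym (↭-length (rots-↭ t L))))
                (trans (sumTo-rots g (rots t L)) (count-↭ g (rots-↭ t L)))
  ... | i , lt′ with rots i (c ∷ C) in eq | rots-cycle i (c , C , refl , cyc) | subst (λ L → head-bit g L < head-bit f (rots i (c ∷ C))) (rots-comm i t (c ∷ C)) lt′
  ...   | .(u ∷ U) | u , U , refl , cyc′ | lt″ with seg-fro U cyc′
  ...     | z , fro , _ with initial-segment t U [] t≤ fro
    where
    t≤ : t ≤ length U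
    t≤ = ≤-trans le (≤-reflexive (cong (_∸ 1) (trans (sym (↭-length (rots-↭ i (c ∷ C)))) (cong length eq))))
  ...       | R , R′ , w , L , refl , len , fr , r =
    u , R , R′ , w , ↭-sym (subst (_↭ c ∷ C) eq (rots-↭ i (c ∷ C))) , len , fr , T-bit (≤-trans (s≤s z≤n) lt‴) , ¬gw
    where
    lt‴ : bit (g w) < bit (f u)
    lt‴ = subst (λ L → head-bit g L < bit (f u)) (trans (cong (rots t ∘ (u ∷_)) (sym (++-identityʳ≡ (R ++ R′)))) r)
            lt″
    ¬gw : ¬ T (g w)
    ¬gw gw = <-irrefl (bit-T gw) (≤-trans lt‴ (bit≤1 (f u)))

  -- `R′` holds the vertices that the link leaves out, so the permutation makes `R` a selection from
  -- `D`.
  Unlinked : ℕ → List V → V → V → Set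
  Unlinked ℓ D p q = ∀ R R′ → D ↭ R ++ R′ → length R ≡ ℓ → ¬ Seg p R q

  -- Shifting the cycle by ℓ - 1 places maps the out-neighbours of p injectively to those of q.
  unlinked-count : ∀ {D c C p q} ℓ → D ↭ c ∷ C → Cycle c C → 1 ≤ ℓ → ℓ ≤ length D → (∀ {v} → v ∈ D → q ≢ v) →
    Unlinked ℓ D p q → count (A p) D ≤ count (A q) D
  unlinked-count {D} {c} {C} {p} {q} (suc t) π cyc _ le q∉ un = ≮⇒≥ contra
    where
    contra : ¬ count (A q) D < count (A p) D
    contra lt with cycle-window t cyc (≤-pred (≤-trans le (≤-reflexive (↭-length π))))
                     (subst₂ _<_ (count-↭ (A q) π) (count-↭ (A p) π) lt)
    ... | u , R , R′ , w , σ , len , fr , pu , ¬qw =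
      un (u ∷ R) R′ (↭-trans π σ) (cong suc len)
        (pu , fro-step fr (⟶-connex (q∉ (∈-resp-↭ (↭-sym (↭-trans π σ)) (∈-++⁺ˡ (fro-ends fr)))) ¬qw))

-- Paths of prescribed length from the initial to the terminal component

module Passing {m : ℕ} (A : Digraph m) (tour : IsTournament A) where

  open Tournament A tour
  module Flip = Tournament (flip A) (flip-tournament tour)

  flip-to : ∀ {e z q} L H → Flip.Fro e L z → To e H q → ∃ λ H′ → H′ ↭ H ++ L × To z H′ q
  flip-to []      H Flip.stop t = H , ↭-reflexive (sym (++-identityʳ≡ H)) , t
  flip-to (w ∷ L) H (Flip.step a f) t with flip-to L (w ∷ H) f (step a t)
  ... | H′ , p , t′ = H′ , ↭-trans p (↭-sym (shift w H L)) , t′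

  -- `v` goes before the first vertex that it beats, which exists since `v ⟶ z`. That the head is
  -- either `v` or unchanged is recorded because the induction has to attach the preceding vertex to
  -- it.
  to-insert : ∀ {g H q z v} → To g H q → z ∈ H → v ⟶ z → All (v ≢_) H →
    ∃₂ λ g′ H′ → H′ ↭ v ∷ H × To g′ H′ q × (g′ ≡ v ⊎ g′ ≡ g)
  to-insert {g} {v = v} (step a t) z∈ vz (v≢g ∷ ne) with v ⟶? g
  ... | yes vg = v , _ , ↭-refl , step vg (step a t) , inj₁ refl
  to-insert (step a t) (here refl) vz (v≢g ∷ ne) | no ¬vg = ⊥-elim (¬vg vz)
  to-insert {g} {v = v} (step a t) (there z∈) vz (v≢g ∷ ne) | no ¬vg with to-insert t z∈ vz ne
  ... | g′ , H′ , p , t′ , inj₁ refl = g , g ∷ H′ , ↭-trans (prep g p) (swap g v ↭-refl) , step (⟶-connex v≢g ¬vg) t′ , inj₂ refl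
  ... | g′ , H′ , p , t′ , inj₂ refl = g , g ∷ H′ , ↭-trans (prep g p) (swap g v ↭-refl) , step a t′ , inj₂ refl

  -- Every vertex of `E` beats `z`, so all of them can be inserted one by one without disturbing the
  -- last arc into `q`.
  to-extend : ∀ E {z H q} → To z H q → z ∈ H → (∀ {u} → u ∈ E → u ⟶ z) → Unique (E ++ H) →
    ∃₂ λ g H′ → H′ ↭ E ++ H × To g H′ q
  to-extend []      t z∈ dom un = _ , _ , ↭-refl , t
  to-extend (v ∷ E) {H = H} t z∈ dom (v∉ ∷ un) with to-extend E t z∈ (dom ∘ there) un
  ... | g , H′ , p , t′ with to-insert t′ (∈-resp-↭ (↭-sym p) (∈-++⁺ʳ E z∈)) (dom (here refl)) (All-resp-↭ (↭-sym p) v∉)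
  ...   | g′ , H″ , p′ , t″ , _ = g′ , H″ , ↭-trans p′ (prep v p) , t″

  fro-take : ∀ {u z} t G → t ≤ length G → Fro u G z → ∃₂ λ G₁ G₂ → G ≡ G₁ ++ G₂ × length G₁ ≡ t × ∃ (Fro u G₁)
  fro-take zero    G       le f = [] , G , refl , refl , _ , stop
  fro-take (suc t) (w ∷ G) (s≤s le) (step a f) with fro-take t G le f
  ... | G₁ , G₂ , refl , len , z , f′ = w ∷ G₁ , G₂ , refl , cong suc len , z , step a f′

  to-drop : ∀ {g q H} t → t ≤ length H → To g H q → ∃₂ λ H₁ H₂ → H ≡ H₁ ++ H₂ × length H₂ ≡ t × ∃ λ g′ → To g′ H₂ q
  to-drop {H = []} zero le t = [] , [] , refl , refl , _ , t
  to-drop {H = u ∷ H} t le (step a to) with m≤n⇒m<n∨m≡n le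
  ... | inj₂ refl = [] , u ∷ H , refl , refl , _ , step a to
  ... | inj₁ lt with to-drop t (≤-pred lt) to
  ...   | H₁ , H₂ , refl , len , g′ , t′ = u ∷ H₁ , H₂ , refl , len , g′ , t′

  to-head : ∀ {g H q} → 1 ≤ length H → To g H q → g ∈ H
  to-head _ (step _ _) = here refl

  -- For a path on `ℓ` vertices, of which `suc i` come from the initial component, as few as
  -- possible, and `j` from the rest.
  split-+ : ∀ a b ℓ → 1 ≤ b → 2 ≤ ℓ → ℓ ≤ suc a + b → ∃₂ λ i j → i ≤ a × 1 ≤ j × j ≤ b × suc i + j ≡ ℓ
  split-+ a b (suc ℓ) 1≤b (s≤s 1≤ℓ) (s≤s le) with ℓ ≤? b
  ... | yes ℓ≤b = 0 , ℓ , z≤n , 1≤ℓ , ℓ≤b , refl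
  ... | no  ℓ≰b = ℓ ∸ b , b , m≤n+o⇒m∸n≤o ℓ b (≤-trans le (≤-reflexive (+-comm a b))) , 1≤b , ≤-refl ,
                  cong suc (m∸n+n≡m (<⇒≤ (≰⇒> ℓ≰b)))

  -- The path begins with a stretch of a Hamiltonian path of the initial component from `f`, jumps
  -- into the rest and finishes with the tail of a Hamiltonian path of the rest that ends in `e`.
  -- Both stretches can be cut at will, as the jump is possible between any two vertices.
  passing : ∀ {D f e p q} ℓ (i : Initial D) (j : Flip.Initial (Initial.E i)) → Unique D →
    f ∈ Initial.I i → p ⟶ f → e ∈ Flip.Initial.I j → e ⟶ q → 2 ≤ ℓ → ℓ ≤ length D →
    ∃₂ λ R R′ → D ↭ R ++ R′ × length R ≡ ℓ × Seg p R q
  passing {D} {f} {e} {p} {q} ℓ i j un f∈ pf e∈ eq 2≤ℓ ℓ≤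
    with strong-rotate (Initial.others i) (Initial.strong i) f∈
       | Flip.strong-rotate (Flip.Initial.others j) (Flip.Initial.strong j) e∈
  ... | fs , π , z , fro | es , ρ , w , fro′ with flip-to es [ e ] fro′ (step eq stop)
  -- Traversed backwards from `e`, the terminal component gives a walk into `q`. The remaining
  -- vertices all beat `w`, where this walk begins, and are inserted.
  ... | H , σ , to with to-extend E₂ to w∈H (λ u∈ → Flip.Initial.dominate j w∈J u∈) unE
    where
    E₂ : List V
    E₂ = Flip.Initial.E j
    J : List V
    J = Flip.Initial.I j
    w∈J : w ∈ J
    w∈J = ∈-resp-↭ (↭-sym ρ) (Flip.fro-ends fro′)
    w∈H : w ∈ H
    w∈H = ∈-resp-↭ (↭-sym σ) (Flip.fro-ends fro′)
    unE : Unique (E₂ ++ H)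
    unE = Unique-↭ (↭-trans (Flip.Initial.perm j)
            (↭-trans (++⁺ʳ E₂ (↭-trans ρ (↭-sym σ))) (solve 2 (λ a b → a ⊕ b ⊜ b ⊕ a) ↭-refl H E₂)))
            (Unique-++ʳ (Initial.I i) (Unique-↭ (Initial.perm i) un))
      where open CMS
  ... | g , H′ , τ , to′ with split-+ (length fs) (length H′) ℓ 1≤H′ 2≤ℓ (≤-trans ℓ≤ (≤-reflexive lenD))
    where
    H′↭ : H′ ↭ Initial.E i
    H′↭ = ↭-trans τ (↭-trans (++⁺ˡ _ (↭-trans σ (↭-sym ρ)))
            (↭-trans (solve 2 (λ a b → a ⊕ b ⊜ b ⊕ a) ↭-refl (Flip.Initial.E j) (Flip.Initial.I j)) (↭-sym (Flip.Initial.perm j))))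
      where open CMS
    1≤H′ : 1 ≤ length H′
    1≤H′ = ≤-trans (s≤s z≤n) (≤-trans (m≤n+m (suc (length es)) (length (Flip.Initial.E j)))
             (≤-reflexive (sym (trans (↭-length τ) (trans (length-++ (Flip.Initial.E j)) (cong (length (Flip.Initial.E j) +_) (↭-length σ)))))))
    lenD : length D ≡ suc (length fs) + length H′
    lenD = trans (↭-length (Initial.perm i)) (trans (length-++ (Initial.I i)) (cong₂ _+_ (↭-length π) (sym (↭-length H′↭))))
  ... | a , b , a≤ , 1≤b , b≤ , sum with fro-take a fs a≤ fro | to-drop b b≤ to′
  ... | G₁ , G₂ , refl , len₁ , z′ , fro₁ | H₁ , H₂ , refl , len₂ , g′ , to₂ =
    (f ∷ G₁) ++ H₂ , G₂ ++ H₁ , perm , lenR , pf , fro-seg fro₁ (to-seg (Initial.dominate i z′∈ g′∈) to₂)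
    where
    open CMS
    H′↭ : H₁ ++ H₂ ↭ Initial.E i
    H′↭ = ↭-trans τ (↭-trans (++⁺ˡ _ (↭-trans σ (↭-sym ρ)))
            (↭-trans (solve 2 (λ a b → a ⊕ b ⊜ b ⊕ a) ↭-refl (Flip.Initial.E j) (Flip.Initial.I j)) (↭-sym (Flip.Initial.perm j))))
    z′∈ : z′ ∈ Initial.I i
    z′∈ = ∈-resp-↭ (↭-sym π) (∈-++⁺ˡ (fro-ends fro₁))
    g′∈ : g′ ∈ Initial.E i
    g′∈ = ∈-resp-↭ H′↭ (∈-++⁺ʳ H₁ (to-head (≤-trans 1≤b (≤-reflexive (sym len₂))) to₂))
    lenR : length ((f ∷ G₁) ++ H₂) ≡ ℓ
    lenR = trans (length-++ (f ∷ G₁)) (trans (cong₂ _+_ (cong suc len₁) len₂) sum)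
    perm : D ↭ ((f ∷ G₁) ++ H₂) ++ G₂ ++ H₁
    perm = ↭-trans (Initial.perm i) (↭-trans (++⁺ π (↭-sym H′↭))
             (solve 5 (λ f g₁ g₂ h₁ h₂ → (f ⊕ (g₁ ⊕ g₂)) ⊕ (h₁ ⊕ h₂) ⊜ ((f ⊕ g₁) ⊕ h₂) ⊕ (g₂ ⊕ h₁)) ↭-refl [ f ] G₁ G₂ H₁ H₂))

-- Closes arithmetic contradictions: hypotheses are added up to `a ≤ b`, while a ring identity shows
-- `a ≡ suc b`.
overshoot : ∀ {a b} → a ≤ b → ¬ a ≡ suc b
overshoot le refl = <-irrefl refl le

-- Degree counting

module Degrees {m : ℕ} (A : Digraph m) (tour : IsTournament A) where

  open Tournament A tour

  bit-flip : ∀ {u v} → u ≢ v → bit (A u v) + bit (A v u) ≡ 1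
  bit-flip {u} {v} u≢v with u ⟶? v
  ... | yes uv = cong₂ _+_ (bit-T uv) (bit-¬T (⟶-asym uv))
  ... | no ¬uv = cong₂ _+_ (bit-¬T ¬uv) (bit-T (⟶-connex u≢v ¬uv))

  out+in : ∀ {v} L → All (v ≢_) L → count (A v) L + count (flip A v) L ≡ length L
  out+in []          []         = refl
  out+in {v} (w ∷ L) (v≢w ∷ ne) =
    trans (+-interchange (bit (A v w)) (count (A v) L) (bit (A w v)) (count (flip A v) L))
      (cong₂ _+_ (bit-flip v≢w) (out+in L ne))

  sumOver : (V → ℕ) → List V → ℕ
  sumOver f []      = 0
  sumOver f (v ∷ L) = f v + sumOver f L

  arcs : List V → ℕ
  arcs L = sumOver (λ p → count (A p) L) L

  sumOver-+ : ∀ v (f : V → ℕ) L → sumOver (λ p → bit (A p v) + f p) L ≡ count (flip A v) L + sumOver f L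
  sumOver-+ v f []      = refl
  sumOver-+ v f (w ∷ L) =
    trans (cong ((bit (A w v) + f w) +_) (sumOver-+ v f L)) (+-interchange (bit (A w v)) (f w) _ _)

  -- The arc number `l (l - 1) / 2` without subtraction or division: a new vertex has one arc, out
  -- or in, with every old one.
  arcs-count : ∀ L → Unique L → 2 * arcs L + length L ≡ length L * length L
  arcs-count []      _        = refl
  arcs-count (v ∷ L) (v∉ ∷ un) = begin
    2 * arcs (v ∷ L) + suc (length L)
      ≡⟨ cong (λ a → 2 * a + suc (length L)) step₁ ⟩
    2 * (length L + arcs L) + suc (length L)
      ≡⟨ rearrange (length L) (arcs L) ⟩
    (2 * arcs L + length L) + (2 * length L + 1)
      ≡⟨ cong (_+ (2 * length L + 1)) (arcs-count L un) ⟩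
    length L * length L + (2 * length L + 1)
      ≡⟨ square (length L) ⟩
    suc (length L) * suc (length L) ∎
    where
    open ≡-Reasoning
    rearrange : ∀ l a → 2 * (l + a) + suc l ≡ (2 * a + l) + (2 * l + 1)
    rearrange = solve-∀
    square : ∀ l → l * l + (2 * l + 1) ≡ suc l * suc l
    square = solve-∀
    step₁ : arcs (v ∷ L) ≡ length L + arcs L
    step₁ = begin
      (bit (A v v) + count (A v) L) + sumOver (λ p → bit (A p v) + count (A p) L) L
        ≡⟨ cong₂ (λ b s → (b + count (A v) L) + s) (bit-¬T ⟶-irrefl) (sumOver-+ v _ L) ⟩
      count (A v) L + (count (flip A v) L + arcs L)
        ≡⟨ sym (+-assoc (count (A v) L) _ _) ⟩
      (count (A v) L + count (flip A v) L) + arcs L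
        ≡⟨ cong (_+ arcs L) (out+in L v∉) ⟩
      length L + arcs L ∎

  sumOver-lower : ∀ {c} (f : V → ℕ) L → (∀ {p} → p ∈ L → c ≤ 2 * f p) → length L * c ≤ 2 * sumOver f L
  sumOver-lower f []      h = z≤n
  sumOver-lower f (v ∷ L) h =
    ≤-trans (+-mono-≤ (h (here refl)) (sumOver-lower f L (h ∘ there))) (≤-reflexive (sym (*-distribˡ-+ 2 (f v) _)))

  -- The average outdegree on `l` vertices is `(l - 1) / 2`; if all outdegrees were larger,
  -- `arcs-count` would be exceeded.
  small-outdegree : ∀ L → Unique L → 1 ≤ length L → ∃ λ p → p ∈ L × 2 * count (A p) L + 1 ≤ length L
  small-outdegree L un 1≤ with Any.any? (λ p → 2 * count (A p) L + 1 ≤? length L) L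
  ... | yes some = let p , p∈ , le = find some in p , p∈ , le
  ... | no none = ⊥-elim (1+n≰n (≤-trans 1≤ length≤0))
    where
    large : ∀ {p} → p ∈ L → length L ≤ 2 * count (A p) L
    large {p} p∈ = ≤-pred (≤-trans (≰⇒> (λ le → none (Any.map (λ { refl → le }) p∈))) (≤-reflexive (+-comm _ 1)))
    length≤0 : length L ≤ 0
    length≤0 = +-cancelˡ-≤ (2 * arcs L) (length L) 0
      (≤-trans (≤-reflexive (arcs-count L un)) (≤-trans (sumOver-lower _ L large) (≤-reflexive (sym (+-identityʳ _)))))

  hitBy : List V → V → Bool
  hitBy J u = ⌊ Any.any? (_⟶? u) J ⌋

  hit : ∀ {J j u} → j ∈ J → j ⟶ u → T (hitBy J u)
  hit {J} {j} {u} j∈ ju = fromWitness (Any.map (λ { refl → ju }) j∈)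

  hit⁻¹ : ∀ {J u} → T (hitBy J u) → ∃ λ j → j ∈ J × j ⟶ u
  hit⁻¹ h = find (toWitness h)

  -- A vertex `p` of small outdegree in `J` sends no arc to `E`. So all but at most
  -- `(length J - 1) / 2` of its out-neighbours lie in `K`, and `J` hits at least these.
  sink-bound : ∀ {W K J E k} → W ↭ K ++ J ++ E → Unique J → 1 ≤ length J →
    (∀ {v} → v ∈ W → k ≤ count (A v) W) → (∀ {u v} → u ∈ E → v ∈ J → u ⟶ v) →
    2 * k + 1 ≤ 2 * count (hitBy J) K + length J
  sink-bound {W} {K} {J} {E} {k} π unJ 1≤ deg dom with small-outdegree J unJ 1≤
  ... | p , p∈ , small = begin
    2 * k + 1
      ≤⟨ +-monoˡ-≤ 1 (*-monoʳ-≤ 2 (deg (∈-resp-↭ (↭-sym π) (∈-++⁺ʳ K (∈-++⁺ˡ p∈))))) ⟩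
    2 * count (A p) W + 1
      ≡⟨ cong (λ c → 2 * c + 1) split ⟩
    2 * (count (A p) K + count (A p) J) + 1
      ≡⟨ rearrange (count (A p) K) (count (A p) J) ⟩
    2 * count (A p) K + (2 * count (A p) J + 1)
      ≤⟨ +-mono-≤ (*-monoʳ-≤ 2 (count-mono K (λ _ pu → hit p∈ pu))) small ⟩
    2 * count (hitBy J) K + length J ∎
    where
    open ≤-Reasoning
    rearrange : ∀ a b → 2 * (a + b) + 1 ≡ 2 * a + (2 * b + 1)
    rearrange = solve-∀
    split : count (A p) W ≡ count (A p) K + count (A p) J
    split = trans (count-↭ (A p) π) (trans (count-++ (A p) K _) (cong (count (A p) K +_)
              (trans (count-++ (A p) J E) (trans (cong (count (A p) J +_) (count-none E λ u∈ pu → ⟶-asym pu (dom u∈ p∈))) (+-identityʳ _)))))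

  dominated-bound : ∀ {W J E y n} → W ↭ J ++ E → count (A y) W ≤ n → (∀ {v} → v ∈ J → y ⟶ v) → length J ≤ n
  dominated-bound {W} {J} {E} {y} π deg dom =
    ≤-trans (≤-reflexive (sym (count-all J dom)))
      (≤-trans (≤-trans (m≤m+n _ (count (A y) E)) (≤-reflexive (sym (trans (count-↭ (A y) π) (count-++ (A y) J E))))) deg)

-- Arithmetic of the degree inequalities

≥1⊎≤0 : ∀ c → 1 ≤ c ⊎ c ≤ 0
≥1⊎≤0 zero    = inj₂ z≤n
≥1⊎≤0 (suc _) = inj₁ (s≤s z≤n)

too-few-arith : ∀ k c γ n → 2 * k + 1 + (2 * c + (γ + (2 + n))) ≡ suc (2 * c + γ + (2 * 1 + (n + 2 * k)))
too-few-arith = solve-∀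

separated-arith : ∀ k n a b d e α β D →
  2 * k + 1 + (2 * k + 1 + (2 * (a + b) + (d + (D + suc (d + e) + (α + β + ((2 + n) + 4)))))) ≡
  suc (2 * suc a + α + (2 * suc b + β + (2 * suc d + (2 + e + (n + k + (D + (2 * k + k)))))))
separated-arith = solve-∀

size-arith : ∀ d p q → suc (d + suc (p + q)) ≡ (2 + (p + q)) + d
size-arith = solve-∀

released-arith : ∀ ℓ b a → suc ((suc ℓ + suc b) + a) ≡ ℓ + (suc a + suc (suc b))
released-arith = solve-∀

-- The `c`s count out-neighbours of `p`, the `d`s in-neighbours of `q`, and the `n`s the sizes of
-- the parts. The third and fourth hypotheses are added once, the others twice.
counting-arith : ∀ {k n cB c₁ cR dB d₂ dR nB n₁ n₂ nR} → k ≤ cB + (c₁ + cR) → k ≤ dB + (d₂ + dR) →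
  2 * c₁ + 1 ≤ n₁ → 2 * d₂ + 1 ≤ n₂ → cR + dR ≤ nR → 2 + (nB + (n₁ + (n₂ + nR))) ≤ suc (n + k) →
  2 * k + 4 + 2 * nB + (n₁ + n₂) ≤ 2 * (cB + dB) + 2 * n
counting-arith {k} {n} {cB} {c₁} {cR} {dB} {d₂} {dR} {nB} {n₁} {n₂} {nR} h₁ h₂ h₃ h₄ h₅ h₆ =
  +-cancelʳ-≤ (2 * k + 2 * c₁ + 2 * d₂ + 2 * cR + 2 * dR + n₁ + n₂ + 2 * nR + 2) _ _
    (subst₂ _≤_ (lhs k c₁ d₂ cR dR nB n₁ n₂ nR) (rhs k n cB c₁ cR dB d₂ dR n₁ n₂ nR)
      (+-mono-≤ (*-monoʳ-≤ 2 h₁) (+-mono-≤ (*-monoʳ-≤ 2 h₂) (+-mono-≤ h₃ (+-mono-≤ h₄ (+-mono-≤ (*-monoʳ-≤ 2 h₅) (*-monoʳ-≤ 2 h₆)))))))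
  where
  lhs : ∀ k c₁ d₂ cR dR nB n₁ n₂ nR →
    2 * k + (2 * k + (2 * c₁ + 1 + (2 * d₂ + 1 + (2 * (cR + dR) + 2 * (2 + (nB + (n₁ + (n₂ + nR)))))))) ≡
    2 * k + 4 + 2 * nB + (n₁ + n₂) + (2 * k + 2 * c₁ + 2 * d₂ + 2 * cR + 2 * dR + n₁ + n₂ + 2 * nR + 2)
  lhs = solve-∀
  rhs : ∀ k n cB c₁ cR dB d₂ dR n₁ n₂ nR →
    2 * (cB + (c₁ + cR)) + (2 * (dB + (d₂ + dR)) + (n₁ + (n₂ + (2 * nR + 2 * suc (n + k))))) ≡
    2 * (cB + dB) + 2 * n + (2 * k + 2 * c₁ + 2 * d₂ + 2 * cR + 2 * dR + n₁ + n₂ + 2 * nR + 2)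
  rhs = solve-∀

-- The size conditions eliminate the number `u` of common neighbours and the part sizes `n₁`, `n₂`.
-- What remains concerns a chosen path on `d` vertices, with `s` arcs from `p` to it or from it to
-- `q`.
degree-arith : ∀ {k n u d n₁ n₂ s} e → 2 * k + 4 + 2 * (u + d) + (n₁ + n₂) ≤ 2 * s + 2 * n →
  k ≤ e + (u + n₁) → k ≤ e + (u + n₂) → 2 + n ≤ 2 * k → 8 + 2 * d ≤ 2 * s + 2 * e
degree-arith {k} {n} {u} {d} {n₁} {n₂} {s} e h h₁ h₂ h₃ =
  +-cancelʳ-≤ (4 * k + 2 * u + n₁ + n₂ + 2 * n) _ _
    (subst₂ _≤_ (lhs k n u d n₁ n₂) (rhs k n u n₁ n₂ s e) (+-mono-≤ h (+-mono-≤ h₁ (+-mono-≤ h₂ (*-monoʳ-≤ 2 h₃)))))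
  where
  lhs : ∀ k n u d n₁ n₂ → 2 * k + 4 + 2 * (u + d) + (n₁ + n₂) + (k + (k + 2 * (2 + n))) ≡ 8 + 2 * d + (4 * k + 2 * u + n₁ + n₂ + 2 * n)
  lhs = solve-∀
  rhs : ∀ k n u n₁ n₂ s e → 2 * s + 2 * n + (e + (u + n₁) + (e + (u + n₂) + 2 * (2 * k))) ≡ 2 * s + 2 * e + (4 * k + 2 * u + n₁ + n₂ + 2 * n)
  rhs = solve-∀

-- Linking two disjoint paths, under the assumption that the longer path does not exist

module Setting {m : ℕ} (A : Digraph m) (tour : IsTournament A) (W : List (Fin m)) (unW : Unique W)
  (n k : ℕ) (|W|≡ : length W ≡ suc (n + k))
  (k≤out : ∀ {v} → v ∈ W → k ≤ count (A v) W) (k≤in : ∀ {v} → v ∈ W → k ≤ count (flip A v) W)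
  (out≤n : ∀ {v} → v ∈ W → count (A v) W ≤ n) (in≤n : ∀ {v} → v ∈ W → count (flip A v) W ≤ n)
  (n+2≤2k : 2 + n ≤ 2 * k) (4≤k : 4 ≤ k) (x y : Fin m) (r : ℕ) (3≤r : 3 ≤ r) (r<n+k : suc r ≤ n + k)
  -- The assumption to be refuted: no path of length `r + 1`, which means `r` inner vertices, stays
  -- inside `W`. `M` collects the vertices off the path.
  (fail : ∀ L M → W ↭ (x ∷ y ∷ L) ++ M → length L ≡ r → ¬ Tournament.Seg A tour x L y) where

  open Tournament A tour
  open Rotation A tour using (Unlinked; unlinked-count)
  open Passing A tour using (passing; module Flip)
  open Degrees A tour
  module FlipDegrees = Degrees (flip A) (flip-tournament tour)

  to-start : ∀ {q H v} → To q H v → q ∈ H ++ [ v ]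
  to-start stop       = here refl
  to-start (step _ _) = here refl

  -- `ℓ` is how many vertices of `D` a path through all of `P` and `Q` still needs to have `r` inner
  -- vertices.
  record System (P Q D : List V) (ℓ : ℕ) : Set where
    constructor system
    field
      perm : W ↭ (x ∷ y ∷ P ++ Q) ++ D
      segP : Seg x P y
      segQ : Seg x Q y
      r≡   : r ≡ ℓ + (length P + length Q)

  open System

  opposite : ∀ {P Q D ℓ} → System P Q D ℓ → System Q P D ℓ
  opposite {P} {Q} {D} {ℓ} (system π sP sQ r≡) = system
    (↭-trans π (shuffle-opposite (x ∷ y ∷ []) P Q D))
    sQ sP (trans r≡ (cong (ℓ +_) (+-comm (length P) (length Q))))

  finish : ∀ {P Q D ℓ} → System P Q D ℓ → ∀ N R R′ → N ↭ (P ++ Q) ++ R → D ↭ R ++ R′ → length R ≡ ℓ → ¬ Seg x N y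
  finish {P} {Q} {D} {ℓ} S N R R′ σ τ len = fail N R′ perm′ lenN
    where
    perm′ : W ↭ (x ∷ y ∷ N) ++ R′
    perm′ = ↭-trans (perm S) (↭-trans (++⁺ˡ (x ∷ y ∷ P ++ Q) τ)
      (↭-trans (shuffle-assoc (x ∷ y ∷ []) (P ++ Q) R R′)
        (++⁺ʳ R′ (prep x (prep y (↭-sym σ))))))
    lenN : length N ≡ r
    lenN = trans (↭-length σ) (trans (length-++ (P ++ Q)) (trans (cong₂ _+_ (length-++ P) len) (trans (+-comm (length P + length Q) ℓ) (sym (r≡ S)))))

  unique : ∀ {P Q D ℓ} → System P Q D ℓ → ∀ {R R′} → D ↭ R ++ R′ → Unique ((P ++ Q) ++ R)
  unique {P} {Q} S {R} {R′} τ = Unique-++ˡ ((P ++ Q) ++ R) (Unique-++ʳ (x ∷ y ∷ []) (Unique-↭ perm′ unW))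
    where
    perm′ : W ↭ (x ∷ y ∷ []) ++ ((P ++ Q) ++ R) ++ R′
    perm′ = ↭-trans (perm S) (↭-trans (++⁺ˡ (x ∷ y ∷ P ++ Q) τ)
      (↭-trans (shuffle-assoc (x ∷ y ∷ []) (P ++ Q) R R′) (↭-reflexive (++-assoc≡ (x ∷ y ∷ []) ((P ++ Q) ++ R) R′))))

  -- The unused end of P and the unused beginning of Q are merged into the new path.
  splice : ∀ {p q} G E E′ H R → Unique (((G ++ R ++ H) ++ E) ++ E′) → Fro x G p → Seg p R q → To q H y →
    Seg p E y → Seg x E′ q → ∃ λ N → N ↭ ((G ++ R ++ H) ++ E) ++ E′ × Seg x N y
  splice {p} {q} G E E′ H R un fro s to sE sE′ =
    first (insert-after (G ++ R ++ H) E (Unique-++ˡ ((G ++ R ++ H) ++ E) un)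
            (fro-seg fro (seg-to R s to)) (∈-++⁺ˡ {xs = x ∷ G} (fro-ends fro)) sE)
    where
    first : (∃ λ M → M ↭ (G ++ R ++ H) ++ E × Seg x M y) → ∃ λ N → N ↭ ((G ++ R ++ H) ++ E) ++ E′ × Seg x N y
    first (M , ρ , s₁) = second (insert-before M E′ (Unique-↭ (++⁺ʳ E′ (↭-sym ρ)) un) s₁ q∈M sE′)
      where
      q∈M : q ∈ M ++ [ y ]
      q∈M = [ (λ q∈H → ∈-++⁺ˡ (∈-resp-↭ (↭-sym ρ) (∈-++⁺ˡ (∈-++⁺ʳ G (∈-++⁺ʳ R q∈H))))) , ∈-++⁺ʳ M ]′ (∈-++⁻ H (to-start to))
      second : (∃ λ N → N ↭ M ++ E′ × Seg x N y) → ∃ λ N → N ↭ ((G ++ R ++ H) ++ E) ++ E′ × Seg x N y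
      second (N , σ , s₂) = N , ↭-trans σ (++⁺ʳ E′ ρ) , s₂

  -- The new path follows `P` to `p`, crosses by `R` to `q` and follows `Q` to `y`; `splice`
  -- recovers the abandoned end of `P` and beginning of `Q`, so no vertex of either is lost.
  cross : ∀ {P Q D ℓ p q} → System P Q D ℓ → p ∈ x ∷ P → q ∈ Q ++ [ y ] → Unlinked ℓ D p q
  cross {P} {Q} {D} {ℓ} {p} {q} S p∈ q∈ R R′ τ len s = go (seg-from P (segP S) p∈) (seg-into Q (segQ S) q∈)
    where
    go : (∃₂ λ G E → P ≡ G ++ E × Fro x G p × Seg p E y) → (∃₂ λ E H → Q ≡ E ++ H × Seg x E q × To q H y) → ⊥
    go (G , E , P≡ , fro , sE) (E′ , H , Q≡ , sE′ , to) =
      end (splice G E E′ H R (Unique-↭ all↭ (unique S τ)) fro s to sE sE′)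
      where
      all↭ : (P ++ Q) ++ R ↭ ((G ++ R ++ H) ++ E) ++ E′
      all↭ = ↭-trans (↭-reflexive (cong₂ (λ P Q → (P ++ Q) ++ R) P≡ Q≡)) (shuffle-cross G E E′ H R)
      end : (∃ λ N → N ↭ ((G ++ R ++ H) ++ E) ++ E′ × Seg x N y) → ⊥
      end (N , ρ , sN) = finish S N R R′ (↭-trans ρ (↭-sym all↭)) τ len sN

  -- `R` and the stretch `M` of `P` are both paths from `u` to `v`, so they merge; `Q` as a whole is
  -- merged in afterwards.
  along : ∀ {P Q D ℓ} → System P Q D ℓ → ∀ G u M v H → P ≡ G ++ u ∷ M ++ v ∷ H → Unlinked ℓ D u v
  along {P} {Q} S G u M v H P≡ R R′ τ len s = go (seg-split G (subst (λ P → Seg x P y) P≡ (segP S)))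
    where
    all↭ : (P ++ Q) ++ R ↭ (R ++ M) ++ (G ++ [ u ] ++ [ v ] ++ H) ++ Q
    all↭ = ↭-trans (↭-reflexive (cong (λ P → (P ++ Q) ++ R) P≡)) (shuffle-along G [ u ] M [ v ] H Q R)
    go : Seg x G u × Seg u (M ++ v ∷ H) y → ⊥
    go (s₁ , s′) = go′ (seg-split M s′)
      where
      go′ : Seg u M v × Seg v H y → ⊥
      go′ (sM , s₂) = end (merge R M (Unique-++ˡ (R ++ M) (Unique-↭ all↭ (unique S τ))) s sM)
        where
        end : (∃ λ N → N ↭ R ++ M × Seg u N v) → ⊥
        end (N , ρ , sN) = end′ (insert-after (G ++ u ∷ N ++ v ∷ H) Q (Unique-↭ all↭′ (unique S τ))
                                  (seg-++ G s₁ (seg-++ N sN s₂)) (here refl) (segQ S))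
          where
          all↭′ : (P ++ Q) ++ R ↭ (G ++ u ∷ N ++ v ∷ H) ++ Q
          all↭′ = ↭-trans all↭ (↭-trans (++⁺ʳ _ (↭-sym ρ)) (shuffle-back G [ u ] N [ v ] H Q))
          end′ : (∃ λ N′ → N′ ↭ (G ++ u ∷ N ++ v ∷ H) ++ Q × Seg x N′ y) → ⊥
          end′ (N′ , σ , s₃) = finish S N′ R R′ (↭-trans σ (↭-sym all↭′)) τ len s₃

  -- `c` counts the contacts of a set of `γ` vertices with `K`. A single contact gives
  -- `2k + 1 ≤ 2 + n`, against `n + 2 ≤ 2k`.
  too-few : ∀ {c γ} → 2 * k + 1 ≤ 2 * c + γ → c ≤ 1 → ¬ γ ≤ n
  too-few {c} {γ} b c≤1 γ≤n =
    overshoot (+-mono-≤ b (+-mono-≤ (*-monoʳ-≤ 2 c≤1) (+-mono-≤ γ≤n n+2≤2k))) (too-few-arith k c γ n)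

  -- A Hamiltonian cycle in the remainder `D`

  module _ {P Q D : List V} {ℓ : ℕ} (S : System P Q D ℓ) where

    private
      π : W ↭ (x ∷ y ∷ P ++ Q) ++ D
      π = perm S

    K : List V
    K = x ∷ y ∷ P ++ Q

    |D| : length D + suc (length P + length Q) ≡ n + k
    |D| = suc-injective (begin
      suc (length D + suc (length P + length Q)) ≡⟨ size-arith (length D) (length P) (length Q) ⟩
      (2 + (length P + length Q)) + length D     ≡⟨ cong (λ c → 2 + c + length D) (sym (length-++ P)) ⟩
      length K + length D                        ≡⟨ sym (length-++ K) ⟩
      length (K ++ D)                            ≡⟨ sym (↭-length π) ⟩
      length W                                   ≡⟨ |W|≡ ⟩
      suc (n + k) ∎)
      where open ≡-Reasoning

    ℓ≤|D| : ℓ ≤ length D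
    ℓ≤|D| = +-cancelʳ-≤ (suc (length P + length Q)) ℓ (length D)
      (≤-trans (≤-reflexive (trans (+-suc ℓ _) (cong suc (sym (r≡ S))))) (≤-trans r<n+k (≤-reflexive (sym |D|))))

    unD : Unique D
    unD = Unique-++ʳ K (Unique-↭ π unW)

    D∉K : ∀ {u v} → u ∈ K → v ∈ D → u ≢ v
    D∉K = Unique-disjoint K (Unique-↭ π unW)

    K⊆W : ∀ {v} → v ∈ K → v ∈ W
    K⊆W v∈ = ∈-resp-↭ (↭-sym π) (∈-++⁺ˡ v∈)

    count-K : ∀ f → count f K ≡ bit (f x) + (bit (f y) + (count f P + count f Q))
    count-K f = cong (λ c → bit (f x) + (bit (f y) + c)) (count-++ f P Q)

    -- To be applied with `p` the vertices having an arc into the initial component of `D`, of size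
    -- `α`, and `q` those having an arc from the terminal one, of size `β`. `passing` links every
    -- `p`-vertex to every `q`-vertex, and `apart` is the contrapositive.
    module _ {p q : V → Bool} {α β : ℕ}
      (apart : ∀ {u v} → Unlinked ℓ D u v → T (p u) → ¬ T (q v))
      (boundα : 2 * k + 1 ≤ 2 * count p K + α) (boundβ : 2 * k + 1 ≤ 2 * count q K + β)
      (α≤n : ¬ T (p x) → α ≤ n) (β≤n : ¬ T (q y) → β ≤ n) (α+β≤ : α + β ≤ length D) where

      private
        q-few : ¬ T (q y) → count q P + count q Q ≤ 0 → ⊥
        q-few ¬qy zero′ = too-few boundβ
          (≤-trans (≤-reflexive (count-K q)) (+-mono-≤ (bit≤1 (q x)) (+-mono-≤ (≤-reflexive (bit-¬T ¬qy)) zero′))) (β≤n ¬qy)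

        p-few : ¬ T (p x) → count p P + count p Q ≤ 0 → ⊥
        p-few ¬px zero′ = too-few boundα
          (≤-trans (≤-reflexive (count-K p)) (≤-trans (+-mono-≤ (≤-reflexive (bit-¬T ¬px)) (+-mono-≤ (bit≤1 (p y)) zero′)) (≤-reflexive refl))) (α≤n ¬px)

        -- `cross` applies from `x` to `y` and to every vertex of `P` and `Q`. Were `x` a
        -- `p`-vertex, only `x` itself could be a `q`-vertex.
        ¬px : ¬ T (p x)
        ¬px px = q-few (apart (cross S (here refl) (∈-++⁺ʳ Q (here refl))) px)
          (≤-reflexive (cong₂ _+_
            (count-none P λ v∈ → apart (cross (opposite S) (here refl) (∈-++⁺ˡ v∈)) px)
            (count-none Q λ v∈ → apart (cross S (here refl) (∈-++⁺ˡ v∈)) px)))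

        ¬qy : ¬ T (q y)
        ¬qy qy = p-few (λ px → apart (cross S (here refl) (∈-++⁺ʳ Q (here refl))) px qy)
          (≤-reflexive (cong₂ _+_
            (count-none P λ v∈ pv → apart (cross S (there v∈) (∈-++⁺ʳ Q (here refl))) pv qy)
            (count-none Q λ v∈ pv → apart (cross (opposite S) (there v∈) (∈-++⁺ʳ P (here refl))) pv qy)))

        -- One path, with `d` vertices, carries all inner `p`- and `q`-vertices. `suc a` allows for
        -- `y` as a `p`-vertex, `suc b` for `x` as a `q`-vertex; the bound on `a + b` comes from
        -- `count-ordered`.
        final : ∀ {a b d e} → 2 * k + 1 ≤ 2 * suc a + α → 2 * k + 1 ≤ 2 * suc b + β → a + b ≤ suc d →
          d ≤ 2 + e → length D + suc (d + e) ≡ n + k → ⊥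
        final {a} {b} {d} {e} b₁ b₂ ord d≤e D≡ =
          overshoot (+-mono-≤ b₁ (+-mono-≤ b₂ (+-mono-≤ (*-monoʳ-≤ 2 ord) (+-mono-≤ d≤e
            (+-mono-≤ (≤-reflexive D≡) (+-mono-≤ α+β≤ (+-mono-≤ n+2≤2k 4≤k)))))))
            (separated-arith k n a b d e α β (length D))

        q-Q : 1 ≤ count p P → count q Q ≡ 0
        q-Q pP = let v , v∈ , pv = count-pos P pP in count-none Q λ w∈ → apart (cross S (there v∈) (∈-++⁺ˡ w∈)) pv

        q-P : 1 ≤ count p Q → count q P ≡ 0
        q-P pQ = let v , v∈ , pv = count-pos Q pQ in count-none P λ w∈ → apart (cross (opposite S) (there v∈) (∈-++⁺ˡ w∈)) pv

        p≤ : count p K ≤ suc (count p P + count p Q)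
        p≤ = ≤-trans (≤-reflexive (count-K p)) (+-mono-≤ (≤-reflexive (bit-¬T ¬px)) (+-monoˡ-≤ _ (bit≤1 (p y))))

        q≤ : count q K ≤ suc (count q P + count q Q)
        q≤ = ≤-trans (≤-reflexive (count-K q)) (+-mono-≤ (bit≤1 (q x)) (+-monoˡ-≤ _ (≤-reflexive (bit-¬T ¬qy))))

        weaken : ∀ {c d γ} → 2 * k + 1 ≤ 2 * c + γ → c ≤ d → 2 * k + 1 ≤ 2 * d + γ
        weaken {γ = γ} b c≤d = ≤-trans b (+-monoˡ-≤ γ (*-monoʳ-≤ 2 c≤d))

        in-P : length P ≤ 2 + length Q → 1 ≤ count p P → count p Q ≤ 0 → ⊥
        in-P P≤Q pP pQ = final {count p P} {count q P} {length P} {length Q}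
          (weaken {d = suc (count p P)} boundα p≤′) (weaken {d = suc (count q P)} boundβ q≤′)
          (count-ordered {p = p} {q = q} P λ G u M v H eq → apart (along S G u M v H eq)) P≤Q |D|
          where
          p≤′ : count p K ≤ suc (count p P)
          p≤′ = ≤-trans p≤ (s≤s (≤-trans (+-monoʳ-≤ (count p P) pQ) (≤-reflexive (+-identityʳ _))))
          q≤′ : count q K ≤ suc (count q P)
          q≤′ = ≤-trans q≤ (s≤s (≤-trans (+-monoʳ-≤ (count q P) (≤-reflexive (q-Q pP))) (≤-reflexive (+-identityʳ _))))

        in-Q : length Q ≤ 2 + length P → count p P ≤ 0 → 1 ≤ count p Q → ⊥
        in-Q Q≤P pP pQ = final {count p Q} {count q Q} {length Q} {length P}
          (weaken {d = suc (count p Q)} boundα p≤′) (weaken {d = suc (count q Q)} boundβ q≤′)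
          (count-ordered {p = p} {q = q} Q λ G u M v H eq → apart (along (opposite S) G u M v H eq)) Q≤P
          (trans (cong (λ c → length D + suc c) (+-comm (length Q) (length P))) |D|)
          where
          p≤′ : count p K ≤ suc (count p Q)
          p≤′ = ≤-trans p≤ (s≤s (+-monoˡ-≤ (count p Q) pP))
          q≤′ : count q K ≤ suc (count q Q)
          q≤′ = ≤-trans q≤ (s≤s (+-monoˡ-≤ (count q Q) (≤-reflexive (q-P pQ))))

      -- By `cross`, a `p`-vertex on one path keeps all `q`-vertices off the other. So either one
      -- kind is missing from both paths, or a single path carries them all, and there `along` lets
      -- no `p`-vertex precede a `q`-vertex.
      separated : length P ≤ 2 + length Q → length Q ≤ 2 + length P → ⊥
      separated P≤Q Q≤P = 
        [ (λ pP → [ both pP , in-P P≤Q pP ]′ (≥1⊎≤0 (count p Q)))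
        , (λ pP → [ in-Q Q≤P pP , neither pP ]′ (≥1⊎≤0 (count p Q))) ]′ (≥1⊎≤0 (count p P))
        where
        both : 1 ≤ count p P → 1 ≤ count p Q → ⊥
        both pP pQ = q-few ¬qy (≤-reflexive (cong₂ _+_ (q-P pQ) (q-Q pP)))
        neither : count p P ≤ 0 → count p Q ≤ 0 → ⊥
        neither pP pQ = p-few ¬px (+-mono-≤ {count p P} {0} {count p Q} {0} pP pQ)

    -- Arcs leaving `J` can only end in `x`. As `y` then dominates `J`, there are at most `n`
    -- vertices in `J`, and one contact is too few.
    sink-contra : ∀ J E → D ↭ J ++ E → 1 ≤ length J → (∀ {u v} → u ∈ E → v ∈ J → u ⟶ v) →
      (∀ {j v} → j ∈ J → v ∈ y ∷ P ++ Q → ¬ j ⟶ v) → ⊥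
    sink-contra J E σ 1≤J dom none = too-few (sink-bound {K = K} {J = J} {E = E} π′ unJ 1≤J k≤out dom) few |J|≤n
      where
      π′ : W ↭ K ++ J ++ E
      π′ = ↭-trans π (++⁺ˡ K σ)
      unJ : Unique J
      unJ = Unique-++ˡ J (Unique-↭ σ unD)
      few : count (hitBy J) K ≤ 1
      few = +-mono-≤ (bit≤1 (hitBy J x)) (≤-reflexive (count-none (y ∷ P ++ Q) λ v∈ h → let j , j∈ , jv = hit⁻¹ h in none j∈ v∈ jv))
      |J|≤n : length J ≤ n
      |J|≤n = dominated-bound {J = J} (↭-trans π′ (shuffle-left K J E)) (out≤n (K⊆W (there (here refl))))
        λ v∈ → ⟶-connex (D∉K (there (here refl)) (∈-resp-↭ (↭-sym σ) (∈-++⁺ˡ v∈)) ∘ sym) (none v∈ (here refl))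

    -- The mirror image: arcs entering `J` can only start in `y`, and `J` dominates `x`.
    source-contra : ∀ J E → D ↭ J ++ E → 1 ≤ length J → (∀ {u v} → u ∈ E → v ∈ J → v ⟶ u) →
      (∀ {j v} → j ∈ J → v ∈ x ∷ P ++ Q → ¬ v ⟶ j) → ⊥
    source-contra J E σ 1≤J dom none = too-few (FlipDegrees.sink-bound {K = K} {J = J} {E = E} π′ unJ 1≤J k≤in dom) few |J|≤n
      where
      π′ : W ↭ K ++ J ++ E
      π′ = ↭-trans π (++⁺ˡ K σ)
      unJ : Unique J
      unJ = Unique-++ˡ J (Unique-↭ σ unD)
      missed : ∀ {v} → v ∈ x ∷ P ++ Q → ¬ T (FlipDegrees.hitBy J v)
      missed v∈ h = let j , j∈ , vj = FlipDegrees.hit⁻¹ h in none j∈ v∈ vj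
      few : count (FlipDegrees.hitBy J) K ≤ 1
      few = +-mono-≤ (≤-reflexive (bit-¬T (missed (here refl))))
              (+-mono-≤ (bit≤1 (FlipDegrees.hitBy J y)) (≤-reflexive (count-none (P ++ Q) (missed ∘ there))))
      |J|≤n : length J ≤ n
      |J|≤n = FlipDegrees.dominated-bound {J = J} (↭-trans π′ (shuffle-left K J E)) (in≤n (K⊆W (here refl)))
        λ v∈ → ⟶-connex (D∉K (here refl) (∈-resp-↭ (↭-sym σ) (∈-++⁺ˡ v∈))) (none v∈ (here refl))

    -- Otherwise `D` has distinct initial and terminal strong components. `passing` links through
    -- them on any number of vertices from two on, hence `2 ≤ ℓ`, and their degree bounds feed
    -- `separated`.
    hamiltonian : length P ≤ 2 + length Q → length Q ≤ 2 + length P → 2 ≤ ℓ → ∃₂ λ c C → D ↭ c ∷ C × Cycle c C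
    hamiltonian P≤Q Q≤P 2≤ℓ = [ id , ⊥-elim ∘ absurd ]′ (cycle⊎rest i 2≤|D|)
      where
      2≤|D| : 2 ≤ length D
      2≤|D| = ≤-trans 2≤ℓ ℓ≤|D|
      i : Initial D
      i = initial′ D (≤-trans (s≤s z≤n) 2≤|D|) unD
      absurd : 1 ≤ length (Initial.E i) → ⊥
      absurd 1≤E = separated {p = FlipDegrees.hitBy I} {q = hitBy J} {α = length I} {β = length J} apart bα bβ α≤ β≤ sizes P≤Q Q≤P
        where
        I E : List V
        I = Initial.I i
        E = Initial.E i
        σ : D ↭ I ++ E
        σ = Initial.perm i
        unI++E : Unique (I ++ E)
        unI++E = Unique-↭ σ unD
        -- Taken inside `E`, the terminal component is automatically disjoint from `I`.
        j : Flip.Initial E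
        j = Flip.initial′ E 1≤E (Unique-++ʳ I unI++E)
        J E₂ : List V
        J = Flip.Initial.I j
        E₂ = Flip.Initial.E j
        perm₂ : W ↭ K ++ J ++ (I ++ E₂)
        perm₂ = ↭-trans π (++⁺ˡ K (↭-trans σ (↭-trans (++⁺ˡ I (Flip.Initial.perm j))
          (shuffle-left I J E₂))))
        J⊆E : ∀ {v} → v ∈ J → v ∈ E
        J⊆E v∈ = ∈-resp-↭ (↭-sym (Flip.Initial.perm j)) (∈-++⁺ˡ v∈)
        apart : ∀ {u v} → Unlinked ℓ D u v → T (FlipDegrees.hitBy I u) → ¬ T (hitBy J v)
        apart un pu qv =
          let f , f∈ , uf = FlipDegrees.hit⁻¹ {I} pu
              g , g∈ , gv = hit⁻¹ {J} qv
              R , R′ , τ , len , s = passing ℓ i j unD f∈ uf g∈ gv 2≤ℓ ℓ≤|D|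
          in un R R′ τ len s
        bα : 2 * k + 1 ≤ 2 * count (FlipDegrees.hitBy I) K + length I
        bα = FlipDegrees.sink-bound {K = K} {J = I} {E = E} (↭-trans π (++⁺ˡ K σ)) (Unique-++ˡ I unI++E) (s≤s z≤n) k≤in (λ u∈ v∈ → Initial.dominate i v∈ u∈)
        bβ : 2 * k + 1 ≤ 2 * count (hitBy J) K + length J
        bβ = sink-bound {K = K} {J = J} {E = I ++ E₂} perm₂ (Unique-++ˡ J (Unique-↭ (Flip.Initial.perm j) (Unique-++ʳ I unI++E))) (s≤s z≤n) k≤out dom₂
          where
          dom₂ : ∀ {u v} → u ∈ I ++ E₂ → v ∈ J → u ⟶ v
          dom₂ u∈ v∈ = [ (λ u∈I → Initial.dominate i u∈I (J⊆E v∈)) , (λ u∈E → Flip.Initial.dominate j v∈ u∈E) ]′ (∈-++⁻ I u∈)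
        I⊆D : ∀ {v} → v ∈ I → v ∈ D
        I⊆D v∈ = ∈-resp-↭ (↭-sym σ) (∈-++⁺ˡ v∈)
        J⊆D : ∀ {v} → v ∈ J → v ∈ D
        J⊆D v∈ = ∈-resp-↭ (↭-sym σ) (∈-++⁺ʳ I (J⊆E v∈))
        α≤ : ¬ T (FlipDegrees.hitBy I x) → length I ≤ n
        α≤ ¬px = FlipDegrees.dominated-bound {J = I}
          (↭-trans π (↭-trans (++⁺ˡ K σ) (shuffle-left K I E)))
          (in≤n (K⊆W (here refl)))
          λ v∈ → ⟶-connex (D∉K (here refl) (I⊆D v∈)) λ xv → ¬px (FlipDegrees.hit {I} v∈ xv)
        β≤ : ¬ T (hitBy J y) → length J ≤ n
        β≤ ¬qy = dominated-bound {J = J}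
          (↭-trans perm₂ (shuffle-left K J (I ++ E₂)))
          (out≤n (K⊆W (there (here refl))))
          λ v∈ → ⟶-connex (D∉K (there (here refl)) (J⊆D v∈) ∘ sym) λ vy → ¬qy (hit {J} v∈ vy)
        sizes : length I + length J ≤ length D
        sizes = ≤-trans (+-monoʳ-≤ (length I) (≤-trans (m≤m+n (length J) (length E₂)) (≤-reflexive (sym (trans (↭-length (Flip.Initial.perm j)) (length-++ J))))))
          (≤-reflexive (sym (trans (↭-length σ) (length-++ I))))

  -- Releasing a vertex of the second path

  module _ {a a′ b′ : V} {as bs D : List V} {ℓ : ℕ} (S : System (a ∷ as) (a′ ∷ b′ ∷ bs) D ℓ) (aa′ : a ⟶ a′) where

    private
      P Q : List V
      P = a ∷ as
      Q = a′ ∷ b′ ∷ bs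
      a′∈K : a′ ∈ K S
      a′∈K = there (there (∈-++⁺ʳ P (here refl)))
      b′∈K : b′ ∈ K S
      b′∈K = there (there (∈-++⁺ʳ P (there (here refl))))
      P⊆K : ∀ {u} → u ∈ P → u ∈ K S
      P⊆K u∈ = there (there (∈-++⁺ˡ u∈))
      Q⊆K : ∀ {v} → v ∈ Q → v ∈ K S
      Q⊆K v∈ = there (there (∈-++⁺ʳ P v∈))

    -- a′ is no longer on the path: it becomes one of the vertices available between a and b′.
    released : Unlinked (suc ℓ) (a′ ∷ D) a b′
    released R R′ τ len s = end (merge (R ++ b′ ∷ bs) as un (seg-++ R s (proj₂ (proj₂ (segQ S)))) (proj₂ (segP S)))
      where
      all↭ : W ↭ (x ∷ y ∷ a ∷ (R ++ b′ ∷ bs) ++ as) ++ R′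
      all↭ = ↭-trans (perm S) (↭-trans (shuffle-release (x ∷ y ∷ []) [ a ] as [ a′ ] (b′ ∷ bs) D)
        (↭-trans (++⁺ˡ _ τ) (shuffle-insert (x ∷ y ∷ []) [ a ] as (b′ ∷ bs) R R′)))
      un : Unique ((R ++ b′ ∷ bs) ++ as)
      un = Unique-++ˡ ((R ++ b′ ∷ bs) ++ as) (Unique-++ʳ (x ∷ y ∷ a ∷ []) (Unique-↭ all↭ unW))
      end : (∃ λ N → N ↭ (R ++ b′ ∷ bs) ++ as × Seg a N y) → ⊥
      end (N , ρ , sN) = fail (a ∷ N) R′ (↭-trans all↭ (++⁺ʳ R′ (prep x (prep y (prep a (↭-sym ρ)))))) lenN (proj₁ (segP S) , sN)
        where
        lenN : suc (length N) ≡ r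
        lenN = trans (cong suc (trans (↭-length ρ) (trans (length-++ (R ++ b′ ∷ bs)) (cong (_+ length as) (trans (length-++ R) (cong (_+ suc (length bs)) len))))))
          (trans (released-arith ℓ (length bs) (length as)) (sym (r≡ S)))

    module _ {c : V} {C : List V} (σ : D ↭ c ∷ C) (cyc : Cycle c C) (1≤ℓ : 1 ≤ ℓ) where

        le : ∀ {p q} → q ∈ K S → Unlinked ℓ D p q → count (A p) D ≤ count (A q) D
        le q∈ = unlinked-count ℓ σ cyc 1≤ℓ (ℓ≤|D| S) (D∉K S q∈)

        1≤|D| : 1 ≤ length D
        1≤|D| = ≤-trans 1≤ℓ (ℓ≤|D| S)

        -- `cross` forbids links in both directions, so `P-Q` and `Q-P` together give all inner
        -- vertices equally many out-neighbours in `D`.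
        P-Q : ∀ {u v} → u ∈ x ∷ P → v ∈ Q → count (A u) D ≤ count (A v) D
        P-Q u∈ v∈ = le (Q⊆K v∈) (cross S u∈ (∈-++⁺ˡ v∈))

        Q-P : ∀ {u v} → v ∈ x ∷ Q → u ∈ P → count (A v) D ≤ count (A u) D
        Q-P v∈ u∈ = le (P⊆K u∈) (cross (opposite S) v∈ (∈-++⁺ˡ u∈))

        -- If `a′` dominated `D`, the equal counts would pass this on to `P`, `Q` and then `y`,
        -- leaving only `x` as a target of arcs out of `D`. The case of no out-neighbours in
        -- `not-none` is symmetric.
        not-all : ¬ length D ≤ count (A a′) D
        not-all full = sink-contra S D [] (↭-reflexive (sym (++-identityʳ≡ D))) 1≤|D| (λ ())
          λ j∈ v∈ jv → ⟶-asym (count-full D (full′ v∈) j∈) jv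
          where
          full-a : length D ≤ count (A a) D
          full-a = ≤-trans full (Q-P (there (here refl)) (here refl))
          full′ : ∀ {v} → v ∈ y ∷ P ++ Q → length D ≤ count (A v) D
          full′ (here refl) = ≤-trans full-a (le (there (here refl)) (cross S (there (here refl)) (∈-++⁺ʳ Q (here refl))))
          full′ (there v∈) = [ (λ v∈P → ≤-trans full (Q-P (there (here refl)) v∈P)) , (λ v∈Q → ≤-trans full-a (P-Q (there (here refl)) v∈Q)) ]′ (∈-++⁻ P v∈)

        not-none : ¬ count (A a′) D ≤ 0
        not-none empty = source-contra S D [] (↭-reflexive (sym (++-identityʳ≡ D))) 1≤|D| (λ ())
          λ j∈ v∈ → count-zero D (empty′ v∈) j∈
          where
          empty-a : count (A a) D ≤ 0
          empty-a = ≤-trans (P-Q (there (here refl)) (here refl)) empty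
          empty′ : ∀ {v} → v ∈ x ∷ P ++ Q → count (A v) D ≤ 0
          empty′ (here refl) = ≤-trans (P-Q (here refl) (here refl)) empty
          empty′ (there v∈) = [ (λ v∈P → ≤-trans (P-Q (there v∈P) (here refl)) empty) , (λ v∈Q → ≤-trans (Q-P (there v∈Q) (here refl)) empty-a) ]′ (∈-++⁻ P v∈)

        a′∉D : All (a′ ≢_) D
        a′∉D = All.tabulate (D∉K S a′∈K)

        larger-cycle : ∃₂ λ d E → a′ ∷ D ↭ d ∷ E × Cycle d E
        larger-cycle =
          let d , d∈ , a′d = count-pos D (≰⇒> not-none)
              e , e∈ , ¬a′e = count-miss D (≰⇒> not-all)
              f , F , τ , cyc′ = cycle-insert C a′ cyc (All-resp-↭ σ a′∉D) (∈-resp-↭ σ e∈) (⟶-connex (D∉K S a′∈K e∈) ¬a′e) (∈-resp-↭ σ d∈) a′d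
          in f , F , ↭-trans (prep a′ σ) τ , cyc′

        -- On the larger cycle `a` gains the out-neighbour `a′`, while `b′` gains none because
        -- `a′ ⟶ b′`. As `released` forbids links from `a` to `b′`, the outdegree of `a` would be at
        -- most that of `b′` there, although they agree on `D`.
        cyclic-contra : ⊥
        cyclic-contra =
          let d , E , τ , cyc′ = larger-cycle
              step₁ = unlinked-count (suc ℓ) τ cyc′ (s≤s z≤n) (s≤s (ℓ≤|D| S)) b′∉ released
          in overshoot (≤-trans (≤-trans (≤-reflexive (cong (_+ count (A a) D) (sym (bit-T aa′)))) step₁)
               (≤-trans (≤-reflexive (cong (_+ count (A b′) D) (bit-¬T (⟶-asym a′b′)))) (Q-P (there (there (here refl))) (here refl)))) refl
          where
          a′b′ : a′ ⟶ b′
          a′b′ = proj₁ (proj₂ (segQ S))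
          b′∉ : ∀ {v} → v ∈ a′ ∷ D → b′ ≢ v
          b′∉ (here refl) = ⟶⇒≢ a′b′ ∘ sym
          b′∉ (there v∈)  = D∉K S b′∈K v∈

  module _ {a a′ b′ : V} {as bs D : List V} (S : System (a ∷ as) (a′ ∷ b′ ∷ bs) D 1) (aa′ : a ⟶ a′) where

    private
      P Q : List V
      P = a ∷ as
      Q = a′ ∷ b′ ∷ bs

      single : ∀ {p q w} → Unlinked 1 D p q → w ∈ D → p ⟶ w → ¬ w ⟶ q
      single un w∈ pw wq = let M , σ = ∈⇒↭ w∈ in un [ _ ] M σ refl (pw , wq)

      P⊆K : ∀ {u} → u ∈ P → u ∈ K S
      P⊆K u∈ = there (there (∈-++⁺ˡ u∈))
      Q⊆K : ∀ {v} → v ∈ Q → v ∈ K S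
      Q⊆K v∈ = there (there (∈-++⁺ʳ P v∈))

      -- The forbidden links from `a` exclude `y` and `Q` as targets. In particular `a′ ⟶ w`, and
      -- then those from `a′` exclude `P`.
      below : ∀ {w} → w ∈ D → a ⟶ w → ∀ {v} → v ∈ y ∷ P ++ Q → ¬ w ⟶ v
      below w∈ aw (here refl) = single (cross S (there (here refl)) (∈-++⁺ʳ Q (here refl))) w∈ aw
      below w∈ aw (there v∈) = [ (λ v∈P → single (cross (opposite S) (there (here refl)) (∈-++⁺ˡ v∈P)) w∈ a′w) , in-Q ]′ (∈-++⁻ P v∈)
        where
        in-Q : ∀ {v} → v ∈ Q → ¬ _ ⟶ v
        in-Q v∈Q = single (cross S (there (here refl)) (∈-++⁺ˡ v∈Q)) w∈ aw
        a′w : a′ ⟶ _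
        a′w = ⟶-connex (D∉K S (Q⊆K (here refl)) w∈ ∘ sym) (in-Q (here refl))

      above : ∀ {w} → w ∈ D → ¬ a ⟶ w → ∀ {v} → v ∈ x ∷ P ++ Q → ¬ v ⟶ w
      above {w} w∈ ¬aw v∈ vw = go v∈ vw
        where
        wa : w ⟶ a
        wa = ⟶-connex (D∉K S (P⊆K (here refl)) w∈) ¬aw
        in-Q : ∀ {v} → v ∈ x ∷ Q → ¬ v ⟶ w
        in-Q v∈Q vw = single (cross (opposite S) v∈Q (∈-++⁺ˡ {xs = P} (here refl))) w∈ vw wa
        wa′ : w ⟶ a′
        wa′ = ⟶-connex (D∉K S (Q⊆K (here refl)) w∈) (in-Q (there (here refl)))
        go : ∀ {v} → v ∈ x ∷ P ++ Q → ¬ v ⟶ w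
        go (here refl) = in-Q (here refl)
        go (there v∈) = [ (λ v∈P vw → single (cross S (there v∈P) (∈-++⁺ˡ {xs = Q} (here refl))) w∈ vw wa′) , (λ v∈Q → in-Q (there v∈Q)) ]′ (∈-++⁻ P v∈)

    -- `passing` needs two vertices, so for `ℓ = 1` the set `D` is instead split into the
    -- out-neighbours `N` of `a` and the rest `M`. `N` is a sink by `below`; if it is empty, `M` is
    -- a source by `above`.
    one-vertex-contra : ⊥
    one-vertex-contra = go (split-by (A a) D)
      where
      go : (∃₂ λ M N → D ↭ M ++ N × (∀ {v} → v ∈ M → ¬ a ⟶ v) × (∀ {v} → v ∈ N → a ⟶ v)) → ⊥
      go (M , N , σ , hM , hN) = [ N-contra , N-empty N refl ]′ (≥1⊎≤0 (length N))
        where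
        M⊆D : ∀ {v} → v ∈ M → v ∈ D
        M⊆D v∈ = ∈-resp-↭ (↭-sym σ) (∈-++⁺ˡ v∈)
        N⊆D : ∀ {v} → v ∈ N → v ∈ D
        N⊆D v∈ = ∈-resp-↭ (↭-sym σ) (∈-++⁺ʳ M v∈)
        M→N : ∀ {u v} → u ∈ M → v ∈ N → u ⟶ v
        -- An arc `v ⟶ u` would give `a ⟶ v ⟶ u ⟶ b′`, a link on two vertices that `released`
        -- excludes.
        M→N {u} {v} u∈ v∈ = ⟶-connex (λ { refl → hM u∈ (hN v∈) }) λ vu →
          let R₁ , σ₁ = ∈⇒↭ (N⊆D v∈)
              u∈R₁ = tail∈ (∈-resp-↭ σ₁ (M⊆D u∈))
              R₂ , σ₂ = ∈⇒↭ u∈R₁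
          in released S aa′ (v ∷ u ∷ []) (a′ ∷ R₂) (↭-trans (prep a′ (↭-trans σ₁ (prep v σ₂))) (↭-sym (shift a′ (v ∷ u ∷ []) R₂)))
               refl (hN v∈ , vu , ⟶-connex (D∉K S (Q⊆K (there (here refl))) (M⊆D u∈)) (above (M⊆D u∈) (hM u∈) (there (∈-++⁺ʳ P (there (here refl))))))
          where
          tail∈ : ∀ {L} → u ∈ v ∷ L → u ∈ L
          tail∈ (here refl) = ⊥-elim (hM u∈ (hN v∈))
          tail∈ (there p)   = p
        N-contra : 1 ≤ length N → ⊥
        N-contra 1≤N = sink-contra S N M (↭-trans σ (shuffle-swap M N)) 1≤N (λ u∈ v∈ → M→N u∈ v∈) λ j∈ → below (N⊆D j∈) (hN j∈)
        N-empty : ∀ N′ → N′ ≡ N → length N ≤ 0 → ⊥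
        N-empty [] refl _ = source-contra S M N σ 1≤M (λ ()) λ j∈ → above (M⊆D j∈) (hM j∈)
          where
          1≤M : 1 ≤ length M
          1≤M = ≤-trans (ℓ≤|D| S) (≤-reflexive (trans (↭-length σ) (cong length (++-identityʳ≡ M))))
        N-empty (_ ∷ _) refl ()

  two-paths : ∀ {a a′ b′ as bs D} ℓ → System (a ∷ as) (a′ ∷ b′ ∷ bs) D ℓ → a ⟶ a′ → 1 ≤ ℓ →
    length (a ∷ as) ≤ 2 + length (a′ ∷ b′ ∷ bs) → length (a′ ∷ b′ ∷ bs) ≤ 2 + length (a ∷ as) → ⊥
  two-paths (suc zero) S aa′ _ _ _ = one-vertex-contra S aa′
  two-paths (suc (suc ℓ)) S aa′ 1≤ℓ P≤Q Q≤P =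
    let c , C , σ , cyc = hamiltonian S P≤Q Q≤P (s≤s (s≤s z≤n)) in cyclic-contra S aa′ σ cyc 1≤ℓ

  -- Two short disjoint paths suffice

  surplus : ∀ {c} → suc c ≤ r → ∃ λ ℓ → 1 ≤ ℓ × r ≡ ℓ + c
  surplus {c} lt = r ∸ c , m<n⇒0<n∸m lt , sym (m∸n+n≡m (<⇒≤ lt))

  -- A `System` without `ℓ`, since two short paths may together have `r` or more inner vertices.
  record Spans (P Q M : List V) : Set where
    constructor spans
    field
      perm : W ↭ (x ∷ y ∷ P ++ Q) ++ M
      segP : Seg x P y
      segQ : Seg x Q y

  Spans-swap : ∀ {P Q M} → Spans P Q M → Spans Q P M
  Spans-swap {P} {Q} {M} (spans π sP sQ) = spans (↭-trans π (shuffle-opposite (x ∷ y ∷ []) P Q M)) sQ sP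

  oriented : ∀ {a a′ b′ as bs M} → Spans (a ∷ as) (a′ ∷ b′ ∷ bs) M → a ⟶ a′ →
    suc (length (a ∷ as) + length (a′ ∷ b′ ∷ bs)) ≤ r →
    length (a ∷ as) ≤ 2 + length (a′ ∷ b′ ∷ bs) → length (a′ ∷ b′ ∷ bs) ≤ 2 + length (a ∷ as) → ⊥
  oriented {a} {a′} {b′} {as} {bs} {M} (spans π sP sQ) aa′ lt P≤Q Q≤P =
    let ℓ , 1≤ℓ , eq = surplus lt in two-paths {a} {a′} {b′} {as} {bs} {M} ℓ (system π sP sQ eq) aa′ 1≤ℓ P≤Q Q≤P

  heads : ∀ {a a′ as as′ M} → Spans (a ∷ as) (a′ ∷ as′) M → a ⟶ a′ ⊎ a′ ⟶ a
  heads {a} {a′} {as} {as′} S =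
    ⟶-total (Unique-disjoint (a ∷ as) (Unique-++ˡ ((a ∷ as) ++ a′ ∷ as′) (Unique-++ʳ (x ∷ y ∷ []) (Unique-↭ (Spans.perm S) unW))) (here refl) (here refl))

  -- Both paths have a second vertex, so they can be exchanged if the arc between their first
  -- vertices points the wrong way.
  long : ∀ {a b a′ b′ as bs M} → Spans (a ∷ b ∷ as) (a′ ∷ b′ ∷ bs) M →
    suc (length (a ∷ b ∷ as) + length (a′ ∷ b′ ∷ bs)) ≤ r →
    length (a ∷ b ∷ as) ≤ 2 + length (a′ ∷ b′ ∷ bs) → length (a′ ∷ b′ ∷ bs) ≤ 2 + length (a ∷ b ∷ as) → ⊥
  long {a} {b} {a′} {b′} {as} {bs} S lt P≤Q Q≤P =
    [ (λ aa′ → oriented S aa′ lt P≤Q Q≤P)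
    , (λ a′a → oriented (Spans-swap S) a′a (≤-trans (≤-reflexive (cong suc (+-comm (length (a′ ∷ b′ ∷ bs)) (length (a ∷ b ∷ as))))) lt) Q≤P P≤Q) ]′ (heads S)

  merged : ∀ {P Q M} → Spans P Q M → ¬ length P + length Q ≡ r
  merged {P} {Q} {M} S eq = end (merge P Q un (Spans.segP S) (Spans.segQ S))
    where
    un : Unique (P ++ Q)
    un = Unique-++ˡ (P ++ Q) (Unique-++ʳ (x ∷ y ∷ []) (Unique-↭ (Spans.perm S) unW))
    end : (∃ λ N → N ↭ P ++ Q × Seg x N y) → ⊥
    end (N , ρ , sN) = fail N M (↭-trans (Spans.perm S) (++⁺ʳ M (prep x (prep y (↭-sym ρ)))))
      (trans (↭-length ρ) (trans (length-++ P) eq)) sN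

  one-two : ∀ {u₁ u₂ u₃ M} → Spans [ u₁ ] (u₂ ∷ u₃ ∷ []) M → u₁ ⟶ u₂ → ⊥
  one-two S u₁u₂ = [ (λ lt → oriented S u₁u₂ lt (s≤s z≤n) (s≤s (s≤s z≤n))) , merged S ]′ (m≤n⇒m<n∨m≡n 3≤r)

  -- `long` covers `r ≥ 5` and merging `r = 4`. For `r = 3`, the winning first vertex is put in
  -- front of the other path.
  two-two : ∀ {a b a′ b′ M} → Spans (a ∷ b ∷ []) (a′ ∷ b′ ∷ []) M → ⊥
  two-two S = [ (λ lt → [ (λ lt′ → long S lt′ (s≤s (s≤s z≤n)) (s≤s (s≤s z≤n))) , merged S ]′ (m≤n⇒m<n∨m≡n lt)) , r≡3 S ]′ (m≤n⇒m<n∨m≡n 3≤r)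
    where
    path : ∀ {a b a′ b′ M} → 3 ≡ r → Spans (a ∷ b ∷ []) (a′ ∷ b′ ∷ []) M → ¬ a ⟶ a′
    path {a} {b} {a′} {b′} {M} eq (spans π (xa , _) (_ , a′b′ , b′y)) aa′ =
      fail (a ∷ a′ ∷ b′ ∷ []) (b ∷ M) (↭-trans π (prep x (prep y (prep a (↭-sym (shift b (a′ ∷ b′ ∷ []) M)))))) eq (xa , aa′ , a′b′ , b′y)
    r≡3 : ∀ {a b a′ b′ M} → Spans (a ∷ b ∷ []) (a′ ∷ b′ ∷ []) M → ¬ 3 ≡ r
    r≡3 S eq = [ path eq S , path eq (Spans-swap S) ]′ (heads S)

  -- The extra case `r = 4` is decided by the arc between `a` and `z`: either `c z a b` is a path,
  -- or `b` and `z f` merge behind `a`.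
  two-three : ∀ {a b c z f M} → Spans (a ∷ b ∷ []) (c ∷ z ∷ f ∷ []) M → ⊥
  two-three {a} {b} {c} {z} {f} {M} S@(spans π (xa , ab , by) (xc , cz , zf , fy)) =
    [ (λ l₄ →
    [ (λ l₅ →
    [ (λ l₆ → long S l₆ (s≤s (s≤s z≤n)) (s≤s (s≤s (s≤s z≤n))))
    , merged S ]′ (m≤n⇒m<n∨m≡n l₅))
    , r≡4 ]′ (m≤n⇒m<n∨m≡n l₄))
    , r≡3 ]′ (m≤n⇒m<n∨m≡n 3≤r)
    where
    un : Unique (a ∷ b ∷ c ∷ z ∷ f ∷ M)
    un = Unique-++ʳ (x ∷ y ∷ []) (Unique-↭ π unW)
    r≡3 : ¬ 3 ≡ r
    r≡3 eq = fail (c ∷ z ∷ f ∷ []) (a ∷ b ∷ M) (↭-trans π (prep x (prep y (shuffle-left (a ∷ b ∷ []) (c ∷ z ∷ f ∷ []) M)))) eq (xc , cz , zf , fy)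
    r≡4 : ¬ 4 ≡ r
    r≡4 eq = [ forward , backward ]′ arc
      where
      arc : a ⟶ z ⊎ z ⟶ a
      arc = ⟶-total (Unique-disjoint (a ∷ b ∷ []) un (here refl) (there (here refl)))
      backward : ¬ z ⟶ a
      backward za = fail (c ∷ z ∷ a ∷ b ∷ []) (f ∷ M) (↭-trans π (prep x (prep y (shuffle-left (a ∷ b ∷ []) (c ∷ z ∷ []) (f ∷ M))))) eq (xc , cz , za , ab , by)
      forward : ¬ a ⟶ z
      forward az = end (merge [ b ] (z ∷ f ∷ []) un′ (ab , by) (az , zf , fy))
        where
        σ : a ∷ b ∷ c ∷ z ∷ f ∷ M ↭ a ∷ (b ∷ z ∷ f ∷ []) ++ c ∷ M
        σ = prep a (prep b (↭-sym (shift c (z ∷ f ∷ []) M)))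
        un′ : Unique (b ∷ z ∷ f ∷ [])
        un′ = Unique-++ˡ (b ∷ z ∷ f ∷ []) (Unique-++ʳ [ a ] (Unique-↭ σ un))
        end : (∃ λ N → N ↭ b ∷ z ∷ f ∷ [] × Seg a N y) → ⊥
        end (N , ρ , sN) = fail (a ∷ N) (c ∷ M) (↭-trans π (prep x (prep y (↭-trans σ (prep a (++⁺ʳ (c ∷ M) (↭-sym ρ)))))))
          (trans (cong suc (↭-length ρ)) eq) (xa , sN)

  -- For `r = 4` one first vertex is put in front of the other path. For `r = 5` the arc between the
  -- middle vertices lets `a z` and `a′` merge on the way to `z′`, and `b′` follows.
  three-three : ∀ {a z b a′ z′ b′ M} → Spans (a ∷ z ∷ b ∷ []) (a′ ∷ z′ ∷ b′ ∷ []) M → ⊥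
  three-three S =
    [ (λ l₄ →
    [ (λ l₅ →
    [ (λ l₆ →
    [ (λ l₇ → long S l₇ (s≤s (s≤s (s≤s z≤n))) (s≤s (s≤s (s≤s z≤n))))
    , merged S ]′ (m≤n⇒m<n∨m≡n l₆))
    , r≡5 ]′ (m≤n⇒m<n∨m≡n l₅))
    , r≡4 ]′ (m≤n⇒m<n∨m≡n l₄))
    , r≡3 S ]′ (m≤n⇒m<n∨m≡n 3≤r)
    where
    r≡3 : ∀ {a z b a′ z′ b′ M} → Spans (a ∷ z ∷ b ∷ []) (a′ ∷ z′ ∷ b′ ∷ []) M → ¬ 3 ≡ r
    r≡3 {a} {z} {b} {a′} {z′} {b′} {M} (spans π s _) eq = fail (a ∷ z ∷ b ∷ []) (a′ ∷ z′ ∷ b′ ∷ M) π eq s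
    path₄ : ∀ {a z b a′ z′ b′ M} → 4 ≡ r → Spans (a ∷ z ∷ b ∷ []) (a′ ∷ z′ ∷ b′ ∷ []) M → ¬ a ⟶ a′
    path₄ {a} {z} {b} {a′} {z′} {b′} {M} eq (spans π (xa , _) (_ , s)) aa′ =
      fail (a ∷ a′ ∷ z′ ∷ b′ ∷ []) (z ∷ b ∷ M) (↭-trans π (prep x (prep y (prep a (shuffle-left (z ∷ b ∷ []) (a′ ∷ z′ ∷ b′ ∷ []) M))))) eq (xa , aa′ , s)
    r≡4 : ¬ 4 ≡ r
    r≡4 eq = [ path₄ eq S , path₄ eq (Spans-swap S) ]′ (heads S)
    path₅ : ∀ {a z b a′ z′ b′ M} → 5 ≡ r → Spans (a ∷ z ∷ b ∷ []) (a′ ∷ z′ ∷ b′ ∷ []) M → ¬ z ⟶ z′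
    path₅ {a} {z} {b} {a′} {z′} {b′} {M} eq (spans π (xa , az , _) (xa′ , a′z′ , s)) zz′ =
      end (merge (a ∷ z ∷ []) [ a′ ] un (xa , az , zz′) (xa′ , a′z′))
      where
      σ : a ∷ z ∷ b ∷ a′ ∷ z′ ∷ b′ ∷ M ↭ (a ∷ z ∷ a′ ∷ []) ++ z′ ∷ b′ ∷ b ∷ M
      σ = prep a (prep z (↭-sym (shift b (a′ ∷ z′ ∷ b′ ∷ []) M)))
      un : Unique (a ∷ z ∷ a′ ∷ [])
      un = Unique-++ˡ (a ∷ z ∷ a′ ∷ []) (Unique-↭ σ (Unique-++ʳ (x ∷ y ∷ []) (Unique-↭ π unW)))
      end : (∃ λ N → N ↭ a ∷ z ∷ a′ ∷ [] × Seg x N z′) → ⊥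
      end (N , ρ , sN) = fail (N ++ z′ ∷ b′ ∷ []) (b ∷ M)
        (↭-trans π (prep x (prep y (↭-trans σ (↭-trans (++⁺ʳ (z′ ∷ b′ ∷ b ∷ M) (↭-sym ρ)) (↭-reflexive (sym (++-assoc≡ N (z′ ∷ b′ ∷ []) (b ∷ M)))))))))
        (trans (length-++ N) (trans (cong (_+ 2) (↭-length ρ)) eq)) (seg-++ N sN s)
    r≡5 : ¬ 5 ≡ r
    r≡5 eq = [ path₅ eq S , path₅ eq (Spans-swap S) ]′ (middles S)
      where
      middles : ∀ {a z b a′ z′ b′ M} → Spans (a ∷ z ∷ b ∷ []) (a′ ∷ z′ ∷ b′ ∷ []) M → z ⟶ z′ ⊎ z′ ⟶ z
      middles {a} {z} {b} {a′} {z′} {b′} S =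
        ⟶-total (Unique-disjoint (a ∷ z ∷ b ∷ [])
          (Unique-++ˡ ((a ∷ z ∷ b ∷ []) ++ a′ ∷ z′ ∷ b′ ∷ []) (Unique-++ʳ (x ∷ y ∷ []) (Unique-↭ (Spans.perm S) unW)))
          (there (here refl)) (there (here refl)))

  -- Finding two short paths by counting neighbours

  private
    xy : List V
    xy = x ∷ y ∷ []

  XOnly YOnly Both : V → Set
  XOnly v = x ⟶ v × ¬ v ⟶ y
  YOnly v = ¬ x ⟶ v × v ⟶ y
  Both  v = x ⟶ v × v ⟶ y

  data Outcome (B A₁ A₂ R : List V) (p q : V) : Set where
    arc₁    : ∀ q′ → q′ ∈ A₂ → p ⟶ q′ → Outcome B A₁ A₂ R p q
    arc₂    : ∀ p′ → p′ ∈ A₁ → p′ ⟶ q → Outcome B A₁ A₂ R p q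
    middle  : ∀ v → v ∈ R → p ⟶ v → v ⟶ q → Outcome B A₁ A₂ R p q
    crowded : 2 * k + 4 + 2 * length B + (length A₁ + length A₂) ≤ 2 * (count (A p) B + count (flip A q) B) + 2 * n →
              Outcome B A₁ A₂ R p q

  count-parts : ∀ f (B A₁ A₂ R : List V) → W ↭ xy ++ B ++ A₁ ++ A₂ ++ R →
    count f W ≡ count f xy + (count f B + (count f A₁ + (count f A₂ + count f R)))
  count-parts f B A₁ A₂ R π = trans (count-↭ f π) (trans (count-++ f xy (B ++ A₁ ++ A₂ ++ R)) (cong (count f xy +_)
    (trans (count-++ f B (A₁ ++ A₂ ++ R)) (cong (count f B +_) (trans (count-++ f A₁ (A₂ ++ R)) (cong (count f A₁ +_) (count-++ f A₂ R)))))))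

  length-parts : ∀ (B A₁ A₂ R : List V) → W ↭ xy ++ B ++ A₁ ++ A₂ ++ R →
    2 + (length B + (length A₁ + (length A₂ + length R))) ≡ suc (n + k)
  length-parts B A₁ A₂ R π = trans (cong (2 +_) (sym (trans (length-++ B) (cong (length B +_) (trans (length-++ A₁) (cong (length A₁ +_) (length-++ A₂)))))))
    (trans (sym (↭-length π)) |W|≡)

  -- A vertex p of small outdegree in A₁ and a vertex q of small indegree in A₂ have so many neighbours that,
  -- unless B takes up many of them, there is a walk of length 1 or 2 from p to A₂, from A₁ to q, or from p to q.
  counting : ∀ B A₁ A₂ R → W ↭ xy ++ B ++ A₁ ++ A₂ ++ R → 1 ≤ length A₁ → 1 ≤ length A₂ →
    (∀ {p} → p ∈ A₁ → XOnly p) → (∀ {q} → q ∈ A₂ → YOnly q) →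
    ∃₂ λ p q → p ∈ A₁ × q ∈ A₂ × Outcome B A₁ A₂ R p q
  counting B A₁ A₂ R π 1≤A₁ 1≤A₂ inX inY = go (small-outdegree A₁ un₁ 1≤A₁) (FlipDegrees.small-outdegree A₂ un₂ 1≤A₂)
    where
    un : Unique (A₁ ++ A₂ ++ R)
    un = Unique-++ʳ B (Unique-++ʳ xy (Unique-↭ π unW))
    un₁ : Unique A₁
    un₁ = Unique-++ˡ A₁ un
    un₂ : Unique A₂
    un₂ = Unique-++ˡ A₂ (Unique-++ʳ A₁ un)
    go : (∃ λ p → p ∈ A₁ × 2 * count (A p) A₁ + 1 ≤ length A₁) → (∃ λ q → q ∈ A₂ × 2 * count (flip A q) A₂ + 1 ≤ length A₂) →
      ∃₂ λ p q → p ∈ A₁ × q ∈ A₂ × Outcome B A₁ A₂ R p q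
    go (p , p∈ , small₁) (q , q∈ , small₂) = p , q , p∈ , q∈ ,
      [ (λ (q′ , q′∈ , pq′) → arc₁ q′ q′∈ pq′) , (λ none₁ →
      [ (λ (p′ , p′∈ , p′q) → arc₂ p′ p′∈ p′q) , (λ none₂ →
      [ (λ (v , v∈ , pvq) → let pv , vq = T-∧⁻ pvq in middle v v∈ pv vq) , (λ none₃ → crowded (bound none₁ none₂ none₃)) ]′ (any⊎none (λ v → A p v ∧ A v q) R)) ]′
        (any⊎none (λ u → A u q) A₁)) ]′ (any⊎none (A p) A₂)
      where
      p∈W : p ∈ W
      p∈W = ∈-resp-↭ (↭-sym π) (∈-++⁺ʳ xy (∈-++⁺ʳ B (∈-++⁺ˡ p∈)))
      q∈W : q ∈ W
      q∈W = ∈-resp-↭ (↭-sym π) (∈-++⁺ʳ xy (∈-++⁺ʳ B (∈-++⁺ʳ A₁ (∈-++⁺ˡ q∈))))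
      bound : (∀ v → v ∈ A₂ → ¬ p ⟶ v) → (∀ v → v ∈ A₁ → ¬ v ⟶ q) → (∀ v → v ∈ R → ¬ T (A p v ∧ A v q)) →
        2 * k + 4 + 2 * length B + (length A₁ + length A₂) ≤ 2 * (count (A p) B + count (flip A q) B) + 2 * n
      bound none₁ none₂ none₃ = counting-arith {k} {n}
        {count (A p) B} {count (A p) A₁} {count (A p) R} {count (flip A q) B} {count (flip A q) A₂} {count (flip A q) R}
        {length B} {length A₁} {length A₂} {length R}
        (≤-trans (k≤out p∈W) (≤-reflexive (trans (count-parts (A p) B A₁ A₂ R π)
          (cong₂ _+_ {count (A p) xy} {0} (count-none xy (λ { (here refl) px → ⟶-asym px (proj₁ (inX p∈)) ; (there (here refl)) → proj₂ (inX p∈) }))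
            (cong (λ c → count (A p) B + (count (A p) A₁ + (c + count (A p) R))) (count-none A₂ (none₁ _)))))))
        (≤-trans (k≤in q∈W) (≤-reflexive (trans (count-parts (flip A q) B A₁ A₂ R π)
          (cong₂ _+_ {count (flip A q) xy} {0} (count-none xy (λ { (here refl) → proj₁ (inY q∈) ; (there (here refl)) yq → ⟶-asym yq (proj₂ (inY q∈)) }))
            (cong (λ c → count (flip A q) B + (c + (count (flip A q) A₂ + count (flip A q) R))) (count-none A₁ (none₂ _)))))))
        small₁ small₂
        (count-disjoint R λ v∈ pv vq → none₃ _ v∈ (T-∧⁺ pv vq))
        (≤-reflexive (length-parts B A₁ A₂ R π))

  data Short : List V → Set where
    two   : ∀ {a b} → Short (a ∷ b ∷ [])
    three : ∀ {a z b} → Short (a ∷ z ∷ b ∷ [])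

  short-two : ∀ {Q p q M} → Short Q → Spans Q (p ∷ q ∷ []) M → ⊥
  short-two two   S = two-two S
  short-two three S = two-three (Spans-swap S)

  short-three : ∀ {Q p v q M} → Short Q → Spans Q (p ∷ v ∷ q ∷ []) M → ⊥
  short-three two   S = two-three S
  short-three three S = three-three S

  -- One short path `Q` has been chosen, and any second short path disjoint from it is a
  -- contradiction. `R` is an arbitrary remainder.
  record Frame (U Q A₁ A₂ R : List V) : Set where
    field
      parts : W ↭ xy ++ (U ++ Q) ++ A₁ ++ A₂ ++ R
      seg   : Seg x Q y
      short : Short Q
      inU   : ∀ {v} → v ∈ U → Both v
      inX   : ∀ {v} → v ∈ A₁ → XOnly v
      inY   : ∀ {v} → v ∈ A₂ → YOnly v

  module _ {U Q A₁ A₂ R : List V} (F : Frame U Q A₁ A₂ R) where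

    open Frame F

    -- Here and in the next three lemmas the second short path is `p q`, `p v q`, `p c` and `c q`: a
    -- vertex of `U` can serve at either end.
    no-arc : ∀ {p q} → p ∈ A₁ → q ∈ A₂ → ¬ p ⟶ q
    no-arc {p} {q} p∈ q∈ pq =
      let A₁′ , σ₁ = ∈⇒↭ p∈
          A₂′ , σ₂ = ∈⇒↭ q∈
      in short-two short (spans
           (↭-trans parts (↭-trans (++⁺ˡ xy (++⁺ˡ (U ++ Q) (++⁺ σ₁ (++⁺ʳ R σ₂)))) (shuffle-pair xy U Q [ p ] A₁′ [ q ] A₂′ R)))
           seg (proj₁ (inX p∈) , pq , proj₂ (inY q∈)))

    no-middle : ∀ {p v q} → p ∈ A₁ → v ∈ R → q ∈ A₂ → p ⟶ v → ¬ v ⟶ q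
    no-middle {p} {v} {q} p∈ v∈ q∈ pv vq =
      let A₁′ , σ₁ = ∈⇒↭ p∈
          A₂′ , σ₂ = ∈⇒↭ q∈
          R′ , σ₃ = ∈⇒↭ v∈
      in short-three short (spans
           (↭-trans parts (↭-trans (++⁺ˡ xy (++⁺ˡ (U ++ Q) (++⁺ σ₁ (++⁺ σ₂ σ₃)))) (shuffle-triple xy U Q [ p ] A₁′ [ q ] A₂′ [ v ] R′)))
           seg (proj₁ (inX p∈) , pv , vq , proj₂ (inY q∈)))

    no-into-U : ∀ {p c} → p ∈ A₁ → c ∈ U → ¬ p ⟶ c
    no-into-U {p} {c} p∈ c∈ pc =
      let A₁′ , σ₁ = ∈⇒↭ p∈
          U′ , σ₂ = ∈⇒↭ c∈
      in short-two short (spans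
           (↭-trans parts (↭-trans (++⁺ˡ xy (++⁺ (++⁺ʳ Q σ₂) (++⁺ʳ (A₂ ++ R) σ₁))) (shuffle-into-U xy [ c ] U′ Q [ p ] A₁′ A₂ R)))
           seg (proj₁ (inX p∈) , pc , proj₂ (inU c∈)))

    no-from-U : ∀ {c q} → c ∈ U → q ∈ A₂ → ¬ c ⟶ q
    no-from-U {c} {q} c∈ q∈ cq =
      let A₂′ , σ₁ = ∈⇒↭ q∈
          U′ , σ₂ = ∈⇒↭ c∈
      in short-two short (spans
           (↭-trans parts (↭-trans (++⁺ˡ xy (++⁺ (++⁺ʳ Q σ₂) (++⁺ˡ A₁ (++⁺ʳ R σ₁)))) (shuffle-from-U xy [ c ] U′ Q A₁ [ q ] A₂′ R)))
           seg (proj₁ (inU c∈) , cq , proj₂ (inY q∈)))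

    -- Only the last outcome of `counting` survives, and `U` contributes no neighbours to it. `e`
    -- allows for the out-neighbours of `x` and in-neighbours of `y` that are used by `Q` or are the
    -- other endpoint.
    crowding : ∀ e → k ≤ e + (length U + length A₁) → k ≤ e + (length U + length A₂) → 1 ≤ length A₁ → 1 ≤ length A₂ →
      ∃₂ λ p q → p ∈ A₁ × q ∈ A₂ × 8 + 2 * length Q ≤ 2 * (count (A p) Q + count (flip A q) Q) + 2 * e
    crowding e k≤₁ k≤₂ 1≤A₁ 1≤A₂ = go (counting (U ++ Q) A₁ A₂ R parts 1≤A₁ 1≤A₂ inX inY)
      where
      go : (∃₂ λ p q → p ∈ A₁ × q ∈ A₂ × Outcome (U ++ Q) A₁ A₂ R p q) →
        ∃₂ λ p q → p ∈ A₁ × q ∈ A₂ × 8 + 2 * length Q ≤ 2 * (count (A p) Q + count (flip A q) Q) + 2 * e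
      go (p , q , p∈ , q∈ , arc₁ q′ q′∈ pq′)  = ⊥-elim (no-arc p∈ q′∈ pq′)
      go (p , q , p∈ , q∈ , arc₂ p′ p′∈ p′q)  = ⊥-elim (no-arc p′∈ q∈ p′q)
      go (p , q , p∈ , q∈ , middle v v∈ pv vq) = ⊥-elim (no-middle p∈ v∈ q∈ pv vq)
      go (p , q , p∈ , q∈ , crowded h) = p , q , p∈ , q∈ ,
        degree-arith {k} {n} {length U} {length Q} {length A₁} {length A₂} {count (A p) Q + count (flip A q) Q} e
          (subst₂ _≤_ (cong (λ c → 2 * k + 4 + 2 * c + (length A₁ + length A₂)) (length-++ U))
            (cong (λ c → 2 * c + 2 * n) (cong₂ _+_ countp countq)) h) k≤₁ k≤₂ n+2≤2k
        where
        countp : count (A p) (U ++ Q) ≡ count (A p) Q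
        countp = trans (count-++ (A p) U Q) (cong (_+ count (A p) Q) (count-none U (no-into-U p∈)))
        countq : count (flip A q) (U ++ Q) ≡ count (flip A q) Q
        countq = trans (count-++ (flip A q) U Q) (cong (_+ count (flip A q) Q) (count-none U (λ c∈ → no-from-U c∈ q∈)))

  -- The path `a b` is given up for `p b` and `a q`, two disjoint paths.
  exchange : ∀ {U a b A₁ A₂ R} → Frame U (a ∷ b ∷ []) A₁ A₂ R → ∀ {p q} → p ∈ A₁ → q ∈ A₂ → x ⟶ a → b ⟶ y → p ⟶ b → ¬ a ⟶ q
  exchange {U} {a} {b} {A₁} {A₂} {R} F {p} {q} p∈ q∈ xa by pb aq =
    let A₁′ , σ₁ = ∈⇒↭ p∈
        A₂′ , σ₂ = ∈⇒↭ q∈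
    in two-two (spans
         (↭-trans (Frame.parts F) (↭-trans (++⁺ˡ xy (++⁺ˡ (U ++ a ∷ b ∷ []) (++⁺ σ₁ (++⁺ʳ R σ₂))))
           (shuffle-exchange xy U [ a ] [ b ] [ p ] A₁′ [ q ] A₂′ R)))
         (proj₁ (Frame.inX F p∈) , pb , by) (xa , aq , proj₂ (Frame.inY F q∈)))

  exchange′ : ∀ {U a b A₁ A₂ R} → Frame U (a ∷ b ∷ []) A₁ A₂ R → ∀ {p q} → p ∈ A₁ → q ∈ A₂ → a ⟶ y → x ⟶ b → p ⟶ a → ¬ b ⟶ q
  exchange′ {U} {a} {b} {A₁} {A₂} {R} F {p} {q} p∈ q∈ ay xb pa bq =
    let A₁′ , σ₁ = ∈⇒↭ p∈
        A₂′ , σ₂ = ∈⇒↭ q∈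
    in two-two (spans
         (↭-trans (Frame.parts F) (↭-trans (++⁺ˡ xy (++⁺ (++⁺ˡ U (swap a b ↭-refl)) (++⁺ σ₁ (++⁺ʳ R σ₂))))
           (shuffle-exchange xy U [ b ] [ a ] [ p ] A₁′ [ q ] A₂′ R)))
         (proj₁ (Frame.inX F p∈) , pa , ay) (xb , bq , proj₂ (Frame.inY F q∈)))

  module _ (U X₁ Y₁ Z : List V) (π : W ↭ xy ++ U ++ X₁ ++ Y₁ ++ Z)
    (inU : ∀ {v} → v ∈ U → Both v) (inX : ∀ {v} → v ∈ X₁ → XOnly v) (inY : ∀ {v} → v ∈ Y₁ → YOnly v)
    (inZ : ∀ {v} → v ∈ Z → ¬ x ⟶ v × ¬ v ⟶ y) where

    -- The `1` stands for `y`, the only possible out-neighbour of `x` outside `U` and `X₁`.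
    sizeX : k ≤ 1 + (length U + length X₁)
    sizeX = ≤-trans (k≤out (∈-resp-↭ (↭-sym π) (here refl))) (≤-trans (≤-reflexive (count-parts (A x) U X₁ Y₁ Z π))
      (+-mono-≤ {count (A x) xy} {1} first (+-mono-≤ (count≤length (A x) U) (≤-trans (+-mono-≤ (count≤length (A x) X₁)
        (≤-reflexive (cong₂ _+_ (count-none Y₁ (proj₁ ∘ inY)) (count-none Z (proj₁ ∘ inZ))))) (≤-reflexive (+-identityʳ _))))))
      where
      first : count (A x) xy ≤ 1
      first = +-mono-≤ (≤-reflexive (bit-¬T ⟶-irrefl)) (≤-trans (≤-reflexive (+-identityʳ _)) (bit≤1 (A x y)))

    sizeY : k ≤ 1 + (length U + length Y₁)
    sizeY = ≤-trans (k≤in (∈-resp-↭ (↭-sym π) (there (here refl)))) (≤-trans (≤-reflexive (count-parts (flip A y) U X₁ Y₁ Z π))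
      (+-mono-≤ {count (flip A y) xy} {1} first (+-mono-≤ (count≤length (flip A y) U)
        (+-mono-≤ {count (flip A y) X₁} {0} (≤-reflexive (count-none X₁ (proj₂ ∘ inX)))
          (≤-trans (+-mono-≤ (count≤length (flip A y) Y₁) (≤-reflexive (count-none Z (proj₂ ∘ inZ)))) (≤-reflexive (+-identityʳ _)))))))
      where
      first : count (flip A y) xy ≤ 1
      first = +-mono-≤ (bit≤1 (A x y)) (≤-reflexive (trans (+-identityʳ _) (bit-¬T ⟶-irrefl)))

    frame-arc : ∀ {a b A₁ A₂} → X₁ ↭ a ∷ A₁ → Y₁ ↭ b ∷ A₂ → a ⟶ b → Frame U (a ∷ b ∷ []) A₁ A₂ Z
    frame-arc {a} {b} {A₁} {A₂} σ₁ σ₂ ab = record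
      { parts = ↭-trans π (↭-trans (++⁺ˡ xy (++⁺ˡ U (++⁺ σ₁ (++⁺ʳ Z σ₂)))) (shuffle-arc xy U [ a ] A₁ [ b ] A₂ Z))
      ; seg   = proj₁ (inX (∈-resp-↭ (↭-sym σ₁) (here refl))) , ab , proj₂ (inY (∈-resp-↭ (↭-sym σ₂) (here refl)))
      ; short = two
      ; inU   = inU
      ; inX   = inX ∘ ∈-resp-↭ (↭-sym σ₁) ∘ there
      ; inY   = inY ∘ ∈-resp-↭ (↭-sym σ₂) ∘ there
      }

    frame-middle : ∀ {a v b A₁ A₂ R} → X₁ ↭ a ∷ A₁ → Z ↭ v ∷ R → Y₁ ↭ b ∷ A₂ → a ⟶ v → v ⟶ b → Frame U (a ∷ v ∷ b ∷ []) A₁ A₂ R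
    frame-middle {a} {v} {b} {A₁} {A₂} {R} σ₁ σ₃ σ₂ av vb = record
      { parts = ↭-trans π (↭-trans (++⁺ˡ xy (++⁺ˡ U (++⁺ σ₁ (++⁺ σ₂ σ₃)))) (shuffle-arc₂ xy U [ a ] A₁ [ b ] A₂ [ v ] R))
      ; seg   = proj₁ (inX (∈-resp-↭ (↭-sym σ₁) (here refl))) , av , vb , proj₂ (inY (∈-resp-↭ (↭-sym σ₂) (here refl)))
      ; short = three
      ; inU   = inU
      ; inX   = inX ∘ ∈-resp-↭ (↭-sym σ₁) ∘ there
      ; inY   = inY ∘ ∈-resp-↭ (↭-sym σ₂) ∘ there
      }

    smaller : ∀ {a : V} {L A : List V} → L ↭ a ∷ A → k ≤ 1 + (length U + length L) → k ≤ 2 + (length U + length A)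
    smaller σ le = ≤-trans le (≤-reflexive (cong suc (trans (cong (length U +_) (↭-length σ)) (+-suc (length U) _))))

    nonempty : ∀ {c} {L : List V} → length U ≤ c → k ≤ 3 ∸ c + (length U + length L) → c ≤ 3 → 1 ≤ length L
    nonempty {c} {L} U≤c le c≤3 = +-cancelˡ-≤ 3 1 (length L)
      (≤-trans 4≤k (≤-trans le (≤-trans (+-monoʳ-≤ (3 ∸ c) (+-monoˡ-≤ (length L) U≤c))
        (≤-reflexive (trans (sym (+-assoc (3 ∸ c) c (length L))) (cong (_+ length L) (m∸n+n≡m c≤3)))))))

    -- With `a b` chosen and `e = 2`, `crowding` demands all four arcs from `p` to `a`, `b` and from
    -- `a`, `b` to `q`. But `exchange` excludes having both `p ⟶ b` and `a ⟶ q`.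
    arc-contra : length U ≤ 1 → ∀ {a b} → a ∈ X₁ → b ∈ Y₁ → ¬ a ⟶ b
    arc-contra U≤1 {a} {b} a∈ b∈ ab =
      let A₁ , σ₁ = ∈⇒↭ a∈
          A₂ , σ₂ = ∈⇒↭ b∈
          F = frame-arc σ₁ σ₂ ab
          p , q , p∈ , q∈ , h = crowding F 2 (smaller σ₁ sizeX) (smaller σ₂ sizeY)
            (nonempty {1} {A₁} U≤1 (smaller σ₁ sizeX) (s≤s z≤n)) (nonempty {1} {A₂} U≤1 (smaller σ₂ sizeY) (s≤s z≤n))
      in from-no (12 ≤? 10) (≤-trans h (+-monoˡ-≤ 4 (*-monoʳ-≤ 2
           (few-arcs (A p a) (A p b) (A a q) (A b q) (exchange F p∈ q∈ (proj₁ (inX a∈)) (proj₂ (inY b∈)))))))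
      where
      few-arcs : ∀ pa pb aq bq → (T pb → ¬ T aq) → (bit pa + (bit pb + 0)) + (bit aq + (bit bq + 0)) ≤ 3
      few-arcs true  true  true  _     h = ⊥-elim (h tt tt)
      few-arcs true  true  false true  h = ≤-refl
      few-arcs true  true  false false h = s≤s (s≤s z≤n)
      few-arcs true  false true  true  h = ≤-refl
      few-arcs true  false true  false h = s≤s (s≤s z≤n)
      few-arcs true  false false true  h = s≤s (s≤s z≤n)
      few-arcs true  false false false h = s≤s z≤n
      few-arcs false true  true  _     h = ⊥-elim (h tt tt)
      few-arcs false true  false true  h = s≤s (s≤s z≤n)
      few-arcs false true  false false h = s≤s z≤n
      few-arcs false false true  true  h = s≤s (s≤s z≤n)
      few-arcs false false true  false h = s≤s z≤n
      few-arcs false false false true  h = s≤s z≤n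
      few-arcs false false false false h = z≤n

    -- With `a v b` chosen, `crowding` demands five of six arcs, but `p ⟶ b` and `a ⟶ q` are both
    -- missing as arcs from `X₁` to `Y₁`.
    middle-contra : length U ≤ 1 → (∀ {a b} → a ∈ X₁ → b ∈ Y₁ → ¬ a ⟶ b) →
      ∀ {a v b} → a ∈ X₁ → v ∈ Z → b ∈ Y₁ → a ⟶ v → ¬ v ⟶ b
    middle-contra U≤1 none {a} {v} {b} a∈ v∈ b∈ av vb =
      let A₁ , σ₁ = ∈⇒↭ a∈
          A₂ , σ₂ = ∈⇒↭ b∈
          R , σ₃ = ∈⇒↭ v∈
          F = frame-middle σ₁ σ₃ σ₂ av vb
          p , q , p∈ , q∈ , h = crowding F 2 (smaller σ₁ sizeX) (smaller σ₂ sizeY)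
            (nonempty {1} {A₁} U≤1 (smaller σ₁ sizeX) (s≤s z≤n)) (nonempty {1} {A₂} U≤1 (smaller σ₂ sizeY) (s≤s z≤n))
          p≤ : count (A p) (a ∷ v ∷ b ∷ []) ≤ 2
          p≤ = +-mono-≤ (bit≤1 (A p a)) (+-mono-≤ (bit≤1 (A p v)) (≤-reflexive (trans (+-identityʳ _) (bit-¬T (none (∈-resp-↭ (↭-sym σ₁) (there p∈)) b∈)))))
          q≤ : count (flip A q) (a ∷ v ∷ b ∷ []) ≤ 2
          q≤ = +-mono-≤ {bit (A a q)} {0} (≤-reflexive (bit-¬T (none a∈ (∈-resp-↭ (↭-sym σ₂) (there q∈)))))
                 (+-mono-≤ (bit≤1 (A v q)) (≤-trans (≤-reflexive (+-identityʳ _)) (bit≤1 (A b q))))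
      in from-no (14 ≤? 12) (≤-trans h (+-monoˡ-≤ 4 (*-monoʳ-≤ 2 (+-mono-≤ p≤ q≤))))

    -- With no path chosen, the crowded case demands three arcs from `p` into `U` or from `U` to
    -- `q`; one vertex allows two.
    few-both : length U ≤ 1 → ⊥
    few-both U≤1 = go (counting U X₁ Y₁ Z π
        (nonempty {2} {X₁} (≤-trans U≤1 (s≤s z≤n)) sizeX (s≤s (s≤s z≤n)))
        (nonempty {2} {Y₁} (≤-trans U≤1 (s≤s z≤n)) sizeY (s≤s (s≤s z≤n))) inX inY)
      where
      go : (∃₂ λ p q → p ∈ X₁ × q ∈ Y₁ × Outcome U X₁ Y₁ Z p q) → ⊥
      go (p , q , p∈ , q∈ , arc₁ q′ q′∈ pq′)   = arc-contra U≤1 p∈ q′∈ pq′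
      go (p , q , p∈ , q∈ , arc₂ p′ p′∈ p′q)   = arc-contra U≤1 p′∈ q∈ p′q
      go (p , q , p∈ , q∈ , middle v v∈ pv vq) = middle-contra U≤1 (arc-contra U≤1) p∈ v∈ q∈ pv vq
      go (p , q , p∈ , q∈ , crowded h) = from-no (8 ≤? 6) (≤-trans
        (degree-arith {k} {n} {length U} {0} {length X₁} {length Y₁} {count (A p) U + count (flip A q) U} 1
          (subst (λ c → 2 * k + 4 + 2 * c + (length X₁ + length Y₁) ≤ 2 * (count (A p) U + count (flip A q) U) + 2 * n) (sym (+-identityʳ (length U))) h)
          sizeX sizeY n+2≤2k)
        (+-monoˡ-≤ 2 (*-monoʳ-≤ 2 (+-mono-≤ (≤-trans (count≤length (A p) U) U≤1) (≤-trans (count≤length (flip A q) U) U≤1)))))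

  -- The path `c c′` uses up the common neighbours. With `e = 3`, `crowding` demands three of four
  -- arcs, but `exchange` and `exchange′` each exclude one of two disjoint pairs.
  two-both : ∀ c c′ X₁ Y₁ Z → W ↭ xy ++ (c ∷ c′ ∷ []) ++ X₁ ++ Y₁ ++ Z →
    (∀ {v} → v ∈ c ∷ c′ ∷ [] → Both v) → (∀ {v} → v ∈ X₁ → XOnly v) → (∀ {v} → v ∈ Y₁ → YOnly v) →
    k ≤ 3 + length X₁ → k ≤ 3 + length Y₁ → ¬ c ⟶ c′
  two-both c c′ X₁ Y₁ Z π inU inX inY k≤₁ k≤₂ cc′ =
    let p , q , p∈ , q∈ , h = crowding F 3 k≤₁ k≤₂ (+-cancelˡ-≤ 3 1 _ (≤-trans 4≤k k≤₁)) (+-cancelˡ-≤ 3 1 _ (≤-trans 4≤k k≤₂))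
        xc , cy = inU (here refl)
        xc′ , c′y = inU (there (here refl))
    in from-no (12 ≤? 10) (≤-trans h (+-monoˡ-≤ 6 (*-monoʳ-≤ 2
         (few-arcs (A p c) (A p c′) (A c q) (A c′ q) (exchange F p∈ q∈ xc c′y) (exchange′ F p∈ q∈ cy xc′)))))
    where
    F : Frame [] (c ∷ c′ ∷ []) X₁ Y₁ Z
    F = record { parts = π ; seg = proj₁ (inU (here refl)) , cc′ , proj₂ (inU (there (here refl))) ; short = two ; inU = λ () ; inX = inX ; inY = inY }
    few-arcs : ∀ pa pb aq bq → (T pb → ¬ T aq) → (T pa → ¬ T bq) → (bit pa + (bit pb + 0)) + (bit aq + (bit bq + 0)) ≤ 2
    few-arcs true  true  true  _     h h′ = ⊥-elim (h tt tt)
    few-arcs true  true  false true  h h′ = ⊥-elim (h′ tt tt)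
    few-arcs true  true  false false h h′ = ≤-refl
    few-arcs true  false _     true  h h′ = ⊥-elim (h′ tt tt)
    few-arcs true  false true  false h h′ = ≤-refl
    few-arcs true  false false false h h′ = s≤s z≤n
    few-arcs false true  true  _     h h′ = ⊥-elim (h tt tt)
    few-arcs false true  false true  h h′ = ≤-refl
    few-arcs false true  false false h h′ = s≤s z≤n
    few-arcs false false true  true  h h′ = ≤-refl
    few-arcs false false true  false h h′ = s≤s z≤n
    few-arcs false false false true  h h′ = s≤s z≤n
    few-arcs false false false false h h′ = z≤n

  -- A Hamiltonian path `h h₂ h₃` splits into the paths `h` and `h₂ h₃`, with the arc `h ⟶ h₂` that
  -- `one-two` asks for.
  three-both : ∀ {u₁ u₂ u₃ M} → W ↭ xy ++ (u₁ ∷ u₂ ∷ u₃ ∷ []) ++ M → (∀ {v} → v ∈ u₁ ∷ u₂ ∷ u₃ ∷ [] → Both v) → ⊥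
  three-both {u₁} {u₂} {u₃} {M} π inU = go (hamiltonian-path u₁ (u₂ ∷ u₃ ∷ []) (Unique-++ˡ (u₁ ∷ u₂ ∷ u₃ ∷ []) (Unique-++ʳ xy (Unique-↭ π unW))))
    where
    go : (∃₂ λ h H → u₁ ∷ u₂ ∷ u₃ ∷ [] ↭ h ∷ H × ∃ (Fro h H)) → ⊥
    go (h , h₂ ∷ h₃ ∷ [] , σ , _ , step hh₂ (step h₂h₃ stop)) =
      one-two (spans (↭-trans π (++⁺ˡ xy (++⁺ʳ M σ))) (in′ (here refl)) (proj₁ (in′ (there (here refl))) , h₂h₃ , proj₂ (in′ (there (there (here refl)))))) hh₂
      where
      in′ : ∀ {v} → v ∈ h ∷ h₂ ∷ h₃ ∷ [] → Both v
      in′ = inU ∘ ∈-resp-↭ (↭-sym σ)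
    go (h , [] , σ , _) = contradiction (↭-length σ) λ ()
    go (h , _ ∷ [] , σ , _) = contradiction (↭-length σ) λ ()
    go (h , _ ∷ _ ∷ _ ∷ _ , σ , _) = contradiction (↭-length σ) λ ()

  by-class : ∀ U X₁ Y₁ Z → W ↭ xy ++ U ++ X₁ ++ Y₁ ++ Z →
    (∀ {v} → v ∈ U → Both v) → (∀ {v} → v ∈ X₁ → XOnly v) → (∀ {v} → v ∈ Y₁ → YOnly v) → (∀ {v} → v ∈ Z → ¬ x ⟶ v × ¬ v ⟶ y) → ⊥
  by-class []           X₁ Y₁ Z π inU inX inY inZ = few-both [] X₁ Y₁ Z π inU inX inY inZ z≤n
  by-class (c ∷ [])     X₁ Y₁ Z π inU inX inY inZ = few-both [ c ] X₁ Y₁ Z π inU inX inY inZ ≤-refl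
  by-class (c ∷ c′ ∷ []) X₁ Y₁ Z π inU inX inY inZ =
    [ two-both c c′ X₁ Y₁ Z π inU inX inY k≤₁ k≤₂
    , two-both c′ c X₁ Y₁ Z (↭-trans π (++⁺ˡ xy (swap c c′ ↭-refl))) (inU ∘ ∈-resp-↭ (swap c′ c ↭-refl)) inX inY k≤₁ k≤₂ ]′
      (⟶-total (All.head (AllPairs.head (Unique-++ʳ xy (Unique-↭ π unW)))))
    where
    k≤₁ : k ≤ 3 + length X₁
    k≤₁ = sizeX (c ∷ c′ ∷ []) X₁ Y₁ Z π inU inX inY inZ
    k≤₂ : k ≤ 3 + length Y₁
    k≤₂ = sizeY (c ∷ c′ ∷ []) X₁ Y₁ Z π inU inX inY inZ
  by-class (u₁ ∷ u₂ ∷ u₃ ∷ U) X₁ Y₁ Z π inU inX inY inZ = three-both {M = U ++ X₁ ++ Y₁ ++ Z} π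
    λ { (here refl) → inU (here refl) ; (there (here refl)) → inU (there (here refl)) ; (there (there (here refl))) → inU (there (there (here refl))) }

  impossible : ∀ H → W ↭ xy ++ H → ⊥
  impossible H π =
    let H₀ , X , σ , h₀ , hX = split-by (A x) H
        Z , Y₁ , τ , hZ , hY = split-by (λ v → A v y) H₀
        X₁ , U , ρ , hX₁ , hU = split-by (λ v → A v y) X
    in by-class U X₁ Y₁ Z
         (↭-trans π (↭-trans (++⁺ˡ xy (↭-trans σ (++⁺ τ ρ))) (shuffle-classes xy Z Y₁ X₁ U)))
         (λ v∈ → hX (∈-resp-↭ (↭-sym ρ) (∈-++⁺ʳ X₁ v∈)) , hU v∈)
         (λ v∈ → hX (∈-resp-↭ (↭-sym ρ) (∈-++⁺ˡ v∈)) , hX₁ v∈)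
         (λ v∈ → h₀ (∈-resp-↭ (↭-sym τ) (∈-++⁺ʳ Z v∈)) , hY v∈)
         (λ v∈ → h₀ (∈-resp-↭ (↭-sym τ) (∈-++⁺ˡ v∈)) , hZ v∈)

-- From the regular tournament to the setting

-- The main argument only refutes the absence of a path; exhaustive search turns this into a path.
any-list? : ∀ {m} r {P : List (Fin m) → Set} → (∀ L → Dec (P L)) → Dec (∃ λ L → length L ≡ r × P L)
any-list? zero P? with P? []
... | yes p = yes ([] , refl , p)
... | no ¬p = no λ { ([] , _ , p) → ¬p p }
any-list? (suc r) P? with any? (λ v → any-list? r (P? ∘ (v ∷_)))
... | yes (v , L , len , p) = yes (v ∷ L , cong suc len , p)
... | no ¬p = no λ { (v ∷ L , len , p) → ¬p (v , L , suc-injective len , p) }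

count-subset : ∀ {m} (S : Subset m) {B : Set} (f : Fin m → B) g → (∀ i → g (f i) ≡ lookup S i) → count g (tabulate f) ≡ ∣ S ∣
count-subset []          f g eq = refl
count-subset (true  ∷ S) f g eq = cong₂ _+_ (cong bit (eq zero)) (count-subset S (f ∘ suc) g (eq ∘ suc))
count-subset (false ∷ S) f g eq = cong₂ _+_ (cong bit (eq zero)) (count-subset S (f ∘ suc) g (eq ∘ suc))

length-filter-T : ∀ {B : Set} (f : B → Bool) L → length (filter (T? ∘ f) L) ≡ count f L
length-filter-T f [] = refl
length-filter-T f (v ∷ L) with f v
... | true  = cong suc (length-filter-T f L)
... | false = length-filter-T f L

∉-lookup : ∀ {m} {S : Subset m} {v} → v ∉ S → ¬ T (lookup S v)
∉-lookup {S = S} {v} v∉ t with lookup S v in eq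
... | true = v∉ (lookup⇒[]= v S eq)

lookup-∉ : ∀ {m} {S : Subset m} {v} → ¬ T (lookup S v) → v ∉ S
lookup-∉ {S = S} {v} ¬t v∈ = ¬t (subst T (sym ([]=⇒lookup v∈)) tt)

last-snoc : ∀ {B : Set} (u : B) L y → last (u ∷ L ++ [ y ]) ≡ just y
last-snoc u []      y = refl
last-snoc u (w ∷ L) y = last-snoc w L y

module Regular {n : ℕ} (A : Digraph (2 * n + 1)) (tour : IsTournament A) (reg : IsRegular A) where

  open Tournament A tour
  open Degrees A tour using (out+in)

  everything : List V
  everything = allFin (2 * n + 1)

  degree-sum : ∀ v → count (A v) everything + count (flip A v) everything ≡ 2 * n
  degree-sum v with ∈⇒↭ (∈-allFin v)
  ... | L , σ = begin
    count (A v) everything + count (flip A v) everything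
      ≡⟨ cong₂ _+_ (count-↭ (A v) σ) (count-↭ (flip A v) σ) ⟩
    (bit (A v v) + count (A v) L) + (bit (A v v) + count (flip A v) L)
      ≡⟨ cong (λ b → (b + count (A v) L) + (b + count (flip A v) L)) (bit-¬T ⟶-irrefl) ⟩
    count (A v) L + count (flip A v) L
      ≡⟨ out+in L (AllPairs.head (Unique-↭ σ (allFin⁺ _))) ⟩
    length L
      ≡⟨ suc-injective (trans (sym (↭-length σ)) (trans (length-tabulate {n = 2 * n + 1} id) (+-comm (2 * n) 1))) ⟩
    2 * n ∎
    where open ≡-Reasoning

  out≡in : ∀ v → count (A v) everything ≡ count (flip A v) everything
  out≡in v = trans (sym (length-filter-T (A v) everything)) (trans (reg v) (length-filter-T (flip A v) everything))

  out≡n : ∀ v → count (A v) everything ≡ n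
  out≡n v = *-cancelˡ-≡ _ _ 2 (trans (cong (count (A v) everything +_) (trans (+-identityʳ _) (out≡in v))) (degree-sum v))

  in≡n : ∀ v → count (flip A v) everything ≡ n
  in≡n v = trans (sym (out≡in v)) (out≡n v)

module Extend {n : ℕ} (5≤n : 5 ≤ n) (A : Digraph (2 * n + 1)) (tour : IsTournament A) (reg : IsRegular A)
  (S : Subset (2 * n + 1)) (2s+2≤n : 2 + 2 * ∣ S ∣ ≤ n) (x y : Fin (2 * n + 1)) (x≢y : x ≢ y) (x∉S : x ∉ S) (y∉S : y ∉ S)
  (r : ℕ) (3≤r : 3 ≤ r) (r<2n-s : suc r + ∣ S ∣ ≤ 2 * n) where

  open Tournament A tour
  open Regular {n} A tour reg

  Interior : List V → Set
  Interior L = Seg x L y × Unique (x ∷ y ∷ L) × All (_∉ S) L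

  seg? : ∀ u L v → Dec (Seg u L v)
  seg? u []      v = u ⟶? v
  seg? u (w ∷ L) v = (u ⟶? w) ×-dec seg? w L v

  interior? : ∀ L → Dec (Interior L)
  interior? L = seg? x L y ×-dec (allPairs? (λ u v → ¬? (u ≟ v)) (x ∷ y ∷ L) ×-dec All.all? (λ v → ¬? (v ∈? S)) L)

  seg-walk : ∀ {u v} L → Seg u L v → Walk A (u ∷ L ++ [ v ])
  seg-walk []      a       = a , tt
  seg-walk (_ ∷ L) (a , s) = a , seg-walk L s

  path : (∃ λ L → length L ≡ r × Interior L) → PathAvoiding A S x y (suc r)
  path (L , len , s , un , av) = record
    { verts    = x ∷ L ++ [ y ]
    ; len      = cong suc (trans (length-++ L) (trans (+-comm (length L) 1) (cong suc len)))
    ; starts   = refl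
    ; ends     = last-snoc x L y
    ; distinct = Unique-↭ σ un
    ; avoids   = All-resp-↭ σ (x∉S ∷ y∉S ∷ av)
    ; arcs     = seg-walk L s
    }
    where
    σ : x ∷ y ∷ L ↭ x ∷ L ++ [ y ]
    σ = prep x (shuffle-swap [ y ] L)

  s k : ℕ
  s = ∣ S ∣
  k = n ∸ s

  s≤n : s ≤ n
  s≤n = ≤-trans (m≤m+n s (s + 0)) (≤-trans (m≤n+m (2 * s) 2) 2s+2≤n)

  k+s : k + s ≡ n
  k+s = m∸n+n≡m s≤n

  n+2≤2k : 2 + n ≤ 2 * k
  n+2≤2k = +-cancelʳ-≤ (2 * s) (2 + n) (2 * k) (begin
    2 + n + 2 * s    ≡⟨ +-comm-middle n s ⟩
    n + (2 + 2 * s)  ≤⟨ +-monoʳ-≤ n 2s+2≤n ⟩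
    n + n            ≡⟨ cong (n +_) (sym (+-identityʳ n)) ⟩
    2 * n            ≡⟨ cong (2 *_) (sym k+s) ⟩
    2 * (k + s)      ≡⟨ *-distribˡ-+ 2 k s ⟩
    2 * k + 2 * s    ∎)
    where
    open ≤-Reasoning
    +-comm-middle : ∀ n s → 2 + n + 2 * s ≡ n + (2 + 2 * s)
    +-comm-middle = solve-∀

  4≤k : 4 ≤ k
  -- `2k` is at least `n + 2`, hence at least `7`.
  4≤k = *-cancelˡ-< 2 3 k (≤-trans (+-monoʳ-≤ 2 5≤n) n+2≤2k)

  n+k+s : n + k + s ≡ 2 * n
  n+k+s = trans (+-assoc n k s) (trans (cong (n +_) k+s) (cong (n +_) (sym (+-identityʳ n))))

  r<n+k : suc r ≤ n + k
  r<n+k = +-cancelʳ-≤ s (suc r) (n + k) (≤-trans r<2n-s (≤-reflexive (sym n+k+s)))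

  unless : ¬ (∃ λ L → length L ≡ r × Interior L) → ⊥
  unless ¬interior = go (split-by (lookup S) everything)
    where
    go : (∃₂ λ W N → everything ↭ W ++ N × (∀ {v} → v ∈ W → ¬ T (lookup S v)) × (∀ {v} → v ∈ N → T (lookup S v))) → ⊥
    go (W , N , σ , hW , hN) =
      let W₁ , σ₁ = ∈⇒↭ (in-W x∉S)
          W₂ , σ₂ = ∈⇒↭ (tail∈ (∈-resp-↭ σ₁ (in-W y∉S)))
      in Setting.impossible A tour W unW n k |W| (k≤ (A _) (out≡n _)) (k≤ (flip A _) (in≡n _)) (≤n (A _) (out≡n _)) (≤n (flip A _) (in≡n _))
           n+2≤2k 4≤k x y r 3≤r r<n+k fail W₂ (↭-trans σ₁ (prep x σ₂))
      where
      unW : Unique W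
      unW = Unique-++ˡ W (Unique-↭ σ (allFin⁺ _))
      in-W : ∀ {v} → v ∉ S → v ∈ W
      in-W {v} v∉ = [ id , (λ v∈ → ⊥-elim (∉-lookup v∉ (hN v∈))) ]′ (∈-++⁻ W (∈-resp-↭ σ (∈-allFin v)))
      tail∈ : ∀ {L} → y ∈ x ∷ L → y ∈ L
      tail∈ (here refl) = ⊥-elim (x≢y refl)
      tail∈ (there y∈)  = y∈
      |N| : length N ≡ s
      |N| = begin
        length N                                    ≡⟨ sym (count-all N hN) ⟩
        count (lookup S) N                          ≡⟨ cong (_+ count (lookup S) N) (sym (count-none W hW)) ⟩
        count (lookup S) W + count (lookup S) N     ≡⟨ sym (trans (count-↭ (lookup S) σ) (count-++ (lookup S) W N)) ⟩
        count (lookup S) everything                 ≡⟨ count-subset S id (lookup S) (λ _ → refl) ⟩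
        s                                           ∎
        where open ≡-Reasoning
      |W| : length W ≡ suc (n + k)
      |W| = +-cancelʳ-≡ s (length W) (suc (n + k)) (begin
        length W + s         ≡⟨ cong (length W +_) (sym |N|) ⟩
        length W + length N  ≡⟨ sym (trans (↭-length σ) (length-++ W)) ⟩
        length everything    ≡⟨ length-tabulate {n = 2 * n + 1} id ⟩
        2 * n + 1            ≡⟨ +-comm (2 * n) 1 ⟩
        suc (2 * n)          ≡⟨ cong suc (sym n+k+s) ⟩
        suc (n + k) + s      ∎)
        where open ≡-Reasoning
      parts : ∀ f → count f everything ≡ count f W + count f N
      parts f = trans (count-↭ f σ) (count-++ f W N)
      k≤ : ∀ f → count f everything ≡ n → ∀ {v} → v ∈ W → k ≤ count f W
      -- Of its `n` neighbours, a vertex loses at most the `s` that lie in `N`.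
      k≤ f eq _ = m≤n+o⇒m∸n≤o n s (≤-trans (≤-reflexive (trans (sym eq) (trans (parts f) (+-comm (count f W) _))))
        (+-monoˡ-≤ (count f W) (≤-trans (count≤length f N) (≤-reflexive |N|))))
      ≤n : ∀ f → count f everything ≡ n → ∀ {v} → v ∈ W → count f W ≤ n
      ≤n f eq _ = ≤-trans (m≤m+n (count f W) (count f N)) (≤-reflexive (trans (sym (parts f)) eq))
      fail : ∀ L M → W ↭ (x ∷ y ∷ L) ++ M → length L ≡ r → ¬ Seg x L y
      fail L M π len seg = ¬interior (L , len , seg , Unique-++ˡ (x ∷ y ∷ L) (Unique-↭ π unW) ,
        All.tabulate λ v∈ → lookup-∉ (hW (∈-resp-↭ (↭-sym π) (there (there (∈-++⁺ˡ v∈))))))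

  extended : PathAvoiding A S x y (suc r)
  extended with any-list? r interior?
  ... | yes p = path p
  ... | no ¬p = ⊥-elim (unless ¬p)

theorem1p5 : (n : ℕ) → 11 ≤ 2 * n + 1 →
    (A : Digraph (2 * n + 1)) → IsTournament A → IsRegular A →
    (S : Subset (2 * n + 1)) → 2 * ∣ S ∣ ≤ n ∸ 2 →
    (x y : Fin (2 * n + 1)) → x ≢ y → x ∉ S → y ∉ S →
    (r : ℕ) → 3 ≤ r → r ≤ 2 * n ∸ ∣ S ∣ ∸ 1 →
    PathAvoiding A S x y r → PathAvoiding A S x y (suc r)
theorem1p5 n 11≤ A tour reg S 2s≤ x y x≢y x∉S y∉S r 3≤r r≤ _ =
  Extend.extended {n} 5≤n A tour reg S 2s+2≤n x y x≢y x∉S y∉S r 3≤r r<2n-s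
  where
  5≤n : 5 ≤ n
  5≤n = *-cancelˡ-≤ 2 (+-cancelʳ-≤ 1 10 (2 * n) 11≤)
  2s+2≤n : 2 + 2 * ∣ S ∣ ≤ n
  2s+2≤n = ≤-trans (+-monoʳ-≤ 2 2s≤) (≤-reflexive (m+[n∸m]≡n (≤-trans (s≤s (s≤s z≤n)) 5≤n)))
  s≤2n : ∣ S ∣ ≤ 2 * n
  s≤2n = ≤-trans (m≤m+n ∣ S ∣ (∣ S ∣ + 0)) (≤-trans (≤-trans (m≤n+m (2 * ∣ S ∣) 2) 2s+2≤n) (m≤m+n n (n + 0)))
  below-pred : ∀ t → r ≤ t ∸ 1 → suc r ≤ t
  -- Truncated subtraction makes this case appear; `3 ≤ r` excludes it.
  below-pred zero    r≤0 = contradiction (≤-trans 3≤r r≤0) λ ()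
  below-pred (suc t) r≤t = s≤s r≤t
  r<2n-s : suc r + ∣ S ∣ ≤ 2 * n
  r<2n-s = ≤-trans (+-monoˡ-≤ ∣ S ∣ (below-pred (2 * n ∸ ∣ S ∣) r≤)) (≤-reflexive (m∸n+n≡m s≤2n))
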